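{- Let $k\ge 2$ and let $\mathbf b=(b_1,\dots,b_{k-1})$ be a sequence of non-negative integers. Then $\mathbf b$ is admissible if and only if $\mathbf b$ is a matching sequence.
   Context: Admissible: $\mathbf b$ is admissible if for every choice of distinct integers $a_1,\dots,a_k$ and every choice of sets of integers $M_1,\dots,M_{k-1}$ with $|M_i|=b_i$, there is a permutation $\pi\in S_k$ such that $\sum_{j=1}^{i}a_{\pi(j)}\notin M_i$ for all $i=1,\dots,k-1$. (Interpretation: a grasshopper starts at $0$ and makes $k$ jumps of signed lengths $a_1,\dots,a_k$ in some order, and after its $i$-th jump must avoid $M_i$.) Matching sequence: to $\mathbf b$ associate the bipartite graph $\mathcal B_{\mathbf b}$ with upper class $U=\{(j,l):1\le j\le l\le k-1\}$, lower class $D_{\mathbf b}=\{(i,t):1\le i\le k-1,\ 1\le t\le b_i\}$, and an edge between $(j,l)\in U$ and $(i,t)\in D_{\mathbf b}$ exactly when $j\le i\le l$. The sequence $\mathbf b$ is a matching sequence if $\mathcal B_{\mathbf b}$ has a matching covering all of $D_{\mathbf b}$. -}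

module Defs where

open import Data.Nat using (ℕ; zero; suc; _∸_)
open import Data.Integer using (ℤ; _+_; 0ℤ)
open import Data.Fin using (Fin; toℕ; _≤_)
import Data.Fin as Fin
open import Data.Fin.Permutation using (Permutation′; _⟨$⟩ʳ_)
open import Data.List using (List; length)
open import Data.List.Membership.Propositional using (_∉_)
open import Data.List.Relation.Unary.Unique.Propositional using (Unique)
open import Data.Product using (Σ; ∃; _×_; _,_; proj₁; proj₂)
open import Function using (_∘_)
open import Function.Definitions using (Injective)
open import Relation.Binary.PropositionalEquality using (_≡_)

-- Indexing convention: 0-based.  For a grasshopper with k jumps we index
-- the jumps by Fin k and the forbidden sets M_1..M_{k-1} by Fin (k ∸ 1);
-- Fin index i corresponds to the paper's index i+1.

prefixSum : ∀ {k} → (Fin k → ℤ) → ℕ → ℤ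
prefixSum {zero}  f m       = 0ℤ
prefixSum {suc k} f zero    = 0ℤ
prefixSum {suc k} f (suc m) = f Fin.zero + prefixSum (f ∘ Fin.suc) m

FinSetℤ : ℕ → Set
FinSetℤ c = Σ (List ℤ) (λ xs → Unique xs × length xs ≡ c)

Admissible : (k : ℕ) → (Fin (k ∸ 1) → ℕ) → Set
Admissible k b =
  (a : Fin k → ℤ) → Injective _≡_ _≡_ a →
  (M : (i : Fin (k ∸ 1)) → FinSetℤ (b i)) →
  ∃ λ (π : Permutation′ k) →
    (i : Fin (k ∸ 1)) →
      prefixSum (λ j → a (π ⟨$⟩ʳ j)) (suc (toℕ i)) ∉ proj₁ (M i)

-- The bipartite graph B_b.
-- Upper class U = {(j,l) : j ≤ l}, with j,l ∈ Fin n  (n = k-1).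
Upper : ℕ → Set
Upper n = Σ (Fin n × Fin n) (λ jl → proj₁ jl ≤ proj₂ jl)

Lower : (n : ℕ) → (Fin n → ℕ) → Set
Lower n b = Σ (Fin n) (λ i → Fin (b i))

Adjacent : ∀ {n} {b : Fin n → ℕ} → Upper n → Lower n b → Set
Adjacent ((j , l) , _) (i , _) = (j ≤ i) × (i ≤ l)

-- A matching covering D_b: an injective assignment of every lower vertex
-- to an adjacent upper vertex.
MatchingSequence : (k : ℕ) → (Fin (k ∸ 1) → ℕ) → Set
MatchingSequence k b =
  ∃ λ (f : Lower (k ∸ 1) b → Upper (k ∸ 1)) →
    Injective _≡_ _≡_ f × ((d : Lower (k ∸ 1) b) → Adjacent {b = b} (f d) d)

{-# OPTIONS --safe #-}
-- With K = k - 1, Hall's condition for the interval graph becomes a longest-path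
-- condition: for all points i₁ < ⋯ < iₘ, the demand b at these points plus the
-- number of intervals that fit into the gaps between them is at most C(k,2).
--
-- If it fails, let the jumps be 0, …, k-1 and let Mᵢ consist of the bᵢ numbers
-- from the longest-path value just before i on. Since s distinct jumps cover at
-- least C(s,2), a grasshopper avoiding all Mᵢ stays above the longest-path value
-- throughout, hence ends beyond C(k,2), the sum of all jumps. If it holds, the
-- intervals that end at the last point can serve part of the demand so that the
-- rest satisfies the condition for one point less.
--
-- Conversely, give each interval (p,q) of a matching the linear factor
-- m - (x₁ + ⋯ + xᵢ) of the element m of Mᵢ matched to it, and let F be the product.
-- For a₁ < ⋯ < aₖ the alternating sum Σ ± F(a ∘ π) is a sum of values of
-- ∏ (E_q - E_p) F, with E_p the shift of x_p by 1, over Gelfand-Tsetlin patterns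
-- with top row a: this is the divisibility of the alternant by the Vandermonde
-- determinant. F has as many factors as there are pairs p < q, so
-- ∏ (E_q - E_p) F is constant, namely the permanent of the incidence matrix of
-- intervals and indices, which the matching makes positive. Hence F(a ∘ π) ≠ 0
-- for some π.
module Submission where

-- Hall's condition for the interval graph, and a matching from it.

module Hall where

  open import Data.Nat
  open import Data.Nat.Properties
  open import Data.Nat.Tactic.RingSolver using (solve-∀)
  open import Data.Product using (_×_; _,_)
  open import Data.Sum using (inj₁; inj₂)
  open import Relation.Nullary using (yes; no; contradiction)
  open import Relation.Binary.Definitions using (tri<; tri≈; tri>)
  open import Relation.Binary.PropositionalEquality

  -- The binomial coefficient C(n,2): the number of intervals on n - 1 points, and the least sum of
  -- n distinct natural numbers.
  T : ℕ → ℕ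
  T zero    = 0
  T (suc n) = n + T n

  -- The maximum of Σ b over the chosen points plus Σ T over the gaps, over all
  -- choices among the first i points, with the last gap ending s past point i.
  -- Hall's condition says φ b K 1 ≤ T (suc K): T (suc K) counts all the
  -- intervals and the gap terms count those that miss every chosen point.
  φ : (ℕ → ℕ) → ℕ → ℕ → ℕ
  φ b zero    s = T s
  φ b (suc i) s = φ b i (suc s) ⊔ (φ b i 1 + b i + T s)

  -- A choice of points that is optimal for `s` is still available for `suc s`. Its last gap term is
  -- `T` of an argument at least `s`, and grows by that argument.
  φ-grow : ∀ b i s → s + φ b i s ≤ φ b i (suc s)
  φ-grow b zero    s = ≤-refl
  φ-grow b (suc i) s = begin
    s + (φ b i (suc s) ⊔ (φ b i 1 + b i + T s))
      ≡⟨ +-distribˡ-⊔ s _ _ ⟩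
    (s + φ b i (suc s)) ⊔ (s + (φ b i 1 + b i + T s))
      ≤⟨ ⊔-mono-≤ (≤-trans (n≤1+n _) (φ-grow b i (suc s)))
                  (≤-reflexive (lemma s (φ b i 1 + b i) (T s))) ⟩
    φ b (suc i) (suc s) ∎
    where
    open ≤-Reasoning
    lemma : ∀ s x t → s + (x + t) ≡ x + (s + t)
    lemma = solve-∀

  -- By `φ-grow`, each further step raises `φ b i` at least as much as it raises `T` at an argument
  -- one smaller.
  φ-convex : ∀ b i s e → φ b i (suc s) + T (e + s) ≤ φ b i (suc (e + s)) + T s
  φ-convex b i s zero    = ≤-refl
  φ-convex b i s (suc e) = begin
    φ b i (suc s) + (e + s + T (e + s))     ≡⟨ lemma (φ b i (suc s)) (e + s) (T (e + s)) ⟩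
    e + s + (φ b i (suc s) + T (e + s))     ≤⟨ +-monoʳ-≤ (e + s) (φ-convex b i s e) ⟩
    e + s + (φ b i (suc (e + s)) + T s)     ≡⟨ +-assoc (e + s) _ _ ⟨
    e + s + φ b i (suc (e + s)) + T s       ≤⟨ +-monoˡ-≤ (T s) (≤-trans (n≤1+n _) (φ-grow b i (suc (e + s)))) ⟩
    φ b i (suc (suc e + s)) + T s           ∎
    where
    open ≤-Reasoning
    lemma : ∀ x y z → x + (y + z) ≡ y + (x + z)
    lemma = solve-∀

  φ-shift : ∀ b i m s → φ b i (m + s) ≤ φ b (m + i) s
  φ-shift b i zero    s = ≤-refl
  φ-shift b i (suc m) s = begin
    φ b i (suc (m + s))   ≡⟨ cong (φ b i) (+-suc m s) ⟨
    φ b i (m + suc s)     ≤⟨ φ-shift b i m (suc s) ⟩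
    φ b (m + i) (suc s)   ≤⟨ m≤m⊔n _ _ ⟩
    φ b (suc m + i) s     ∎
    where open ≤-Reasoning

  -- The demand left to the intervals that end before the last of N points. It
  -- is trimmed only where these intervals run out of room, so excess is small
  -- enough for the N intervals ending at the last point.
  module Trim (b : ℕ → ℕ) (N : ℕ) where

    -- `trim i` depends on `φ trim` at `i`, which involves `trim` only below `i`; hence `φ trim` is
    -- unfolded as `ψ` in a mutual recursion. `room i` is the demand at `i` that brings choices with
    -- last point `i` exactly up to `T N`.
    ψ : ℕ → ℕ → ℕ
    trim room : ℕ → ℕ

    room i = T N ∸ (ψ i 1 + T (N ∸ suc i))
    trim i = b i ⊓ room i

    ψ zero    s = T s
    ψ (suc i) s = ψ i (suc s) ⊔ (ψ i 1 + trim i + T s)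

    ψ≡φ : ∀ i s → ψ i s ≡ φ trim i s
    ψ≡φ zero    s = refl
    ψ≡φ (suc i) s = cong₂ (λ x y → x ⊔ (y + trim i + T s)) (ψ≡φ i (suc s)) (ψ≡φ i 1)

    room-eq : ∀ i r → suc i + r ≡ N → room i ≡ T N ∸ (φ trim i 1 + T r)
    room-eq i r refl = cong₂ (λ x y → T N ∸ (x + T y)) (ψ≡φ i 1) (m+n∸m≡n (suc i) r)

    -- At `r = 1` this is Hall's condition for one point less. Choosing a new point stays within
    -- `T N` by the definition of `room`, whose subtraction is not truncated by `φ-fits`.
    φ-trim≤ : ∀ i r → i + r ≡ N → φ trim i r ≤ T N
    φ-fits  : ∀ i r → suc i + r ≡ N → φ trim i 1 + T r ≤ T N

    φ-fits i r eq = begin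
      φ trim i 1 + T r             ≡⟨ cong (λ x → φ trim i 1 + T x) (+-identityʳ r) ⟨
      φ trim i 1 + T (r + 0)       ≤⟨ φ-convex trim i 0 r ⟩
      φ trim i (suc (r + 0)) + 0   ≡⟨ +-identityʳ _ ⟩
      φ trim i (suc (r + 0))       ≡⟨ cong (λ x → φ trim i (suc x)) (+-identityʳ r) ⟩
      φ trim i (suc r)             ≤⟨ φ-trim≤ i (suc r) (trans (+-suc i r) eq) ⟩
      T N                          ∎
      where open ≤-Reasoning

    room-fills : ∀ i r → suc i + r ≡ N → φ trim i 1 + room i + T r ≡ T N
    room-fills i r eq = begin
      φ trim i 1 + room i + T r                             ≡⟨ lemma (φ trim i 1) (room i) (T r) ⟩
      (φ trim i 1 + T r) + room i                           ≡⟨ cong (φ trim i 1 + T r +_) (room-eq i r eq) ⟩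
      (φ trim i 1 + T r) + (T N ∸ (φ trim i 1 + T r))       ≡⟨ m+[n∸m]≡n (φ-fits i r eq) ⟩
      T N                                                   ∎
      where
      open ≡-Reasoning
      lemma : ∀ x y z → x + y + z ≡ (x + z) + y
      lemma = solve-∀

    φ-trim≤ zero    r refl = ≤-refl
    φ-trim≤ (suc i) r eq   = ⊔-lub (φ-trim≤ i (suc r) (trans (+-suc i r) eq)) (begin
      φ trim i 1 + trim i + T r   ≤⟨ +-monoˡ-≤ (T r) (+-monoʳ-≤ (φ trim i 1) (m⊓n≤n (b i) (room i))) ⟩
      φ trim i 1 + room i + T r   ≡⟨ room-fills i r eq ⟩
      T N                         ∎)
      where open ≤-Reasoning

    φ-trim≥ : ∀ i r → i + r ≡ N → T N ≤ φ trim i r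
    φ-trim≥ i r refl = subst (λ x → T N ≤ φ trim x r) (+-identityʳ i) (φ-shift trim 0 i r)

    excess : ℕ → ℕ
    excess zero    = 0
    excess (suc i) = excess i + (b i ∸ trim i)

    -- Where demand is cut, `trim i` equals `room i`, and choosing `i` is at least as good as
    -- skipping it. So some optimal choice for `trim` contains every point that was cut, and gains
    -- the whole excess when `b` is restored.
    φ-excess : ∀ i s → i + s ≤ N → φ trim i s + excess i ≤ φ b i s
    φ-excess zero    s _   = ≤-reflexive (+-identityʳ _)
    φ-excess (suc i) s i+s≤N = begin
      (φ trim i (suc s) ⊔ X) + (excess i + c)
        ≡⟨ +-distribʳ-⊔ (excess i + c) (φ trim i (suc s)) X ⟩
      (φ trim i (suc s) + (excess i + c)) ⊔ (X + (excess i + c))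
        ≤⟨ ⊔-lub left right ⟩
      φ b (suc i) s ∎
      where
      open ≤-Reasoning
      c X r : ℕ
      c = b i ∸ trim i
      X = φ trim i 1 + trim i + T s
      r = N ∸ suc i
      i+r≡N : suc i + r ≡ N
      i+r≡N = m+[n∸m]≡n (≤-trans (m≤m+n (suc i) s) i+s≤N)
      i+s≤N′ : i + suc s ≤ N
      i+s≤N′ = subst (_≤ N) (sym (+-suc i s)) i+s≤N

      regroup : ∀ p t u e c → p + t + u + (e + c) ≡ (p + e) + (t + c) + u
      regroup = solve-∀

      right : X + (excess i + c) ≤ φ b (suc i) s
      right = begin
        X + (excess i + c)                                 ≡⟨ regroup (φ trim i 1) (trim i) (T s) (excess i) c ⟩
        φ trim i 1 + excess i + (trim i + c) + T s         ≡⟨ cong (λ x → φ trim i 1 + excess i + x + T s) (m+[n∸m]≡n (m⊓n≤m (b i) (room i))) ⟩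
        φ trim i 1 + excess i + b i + T s                  ≤⟨ +-monoˡ-≤ (T s) (+-monoˡ-≤ (b i) (φ-excess i 1 (≤-trans (+-monoʳ-≤ i (s≤s z≤n)) i+s≤N′))) ⟩
        φ b i 1 + b i + T s                                ≤⟨ m≤n⊔m (φ b i (suc s)) _ ⟩
        φ b (suc i) s                                      ∎

      left : φ trim i (suc s) + (excess i + c) ≤ φ b (suc i) s
      left with ≤-total (b i) (room i)
      ... | inj₁ b≤room = begin
        φ trim i (suc s) + (excess i + c)   ≡⟨ cong (λ x → φ trim i (suc s) + (excess i + x)) (trans (cong (b i ∸_) (m≤n⇒m⊓n≡m b≤room)) (n∸n≡0 (b i))) ⟩
        φ trim i (suc s) + (excess i + 0)   ≡⟨ cong (φ trim i (suc s) +_) (+-identityʳ _) ⟩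
        φ trim i (suc s) + excess i         ≤⟨ φ-excess i (suc s) i+s≤N′ ⟩
        φ b i (suc s)                       ≤⟨ m≤m⊔n _ _ ⟩
        φ b (suc i) s                       ∎
      ... | inj₂ room≤b = ≤-trans (+-monoˡ-≤ (excess i + c) dominated) right
        where
        e : ℕ
        e = r ∸ s
        e+s≡r : e + s ≡ r
        e+s≡r = m∸n+n≡m (m+n≤o⇒m≤o∸n s (subst (_≤ N) (+-comm (suc i) s) i+s≤N))
        swap : ∀ x y z → x + y + z ≡ x + z + y
        swap = solve-∀
        -- With `r` in place of `s`, choosing `i` attains the maximum `T N`. Convexity carries the
        -- comparison down to `s ≤ r`.
        dominated : φ trim i (suc s) ≤ X
        dominated = +-cancelʳ-≤ (T r) _ _ (begin
          φ trim i (suc s) + T r          ≡⟨ cong (λ x → φ trim i (suc s) + T x) e+s≡r ⟨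
          φ trim i (suc s) + T (e + s)    ≤⟨ φ-convex trim i s e ⟩
          φ trim i (suc (e + s)) + T s    ≡⟨ cong (λ x → φ trim i (suc x) + T s) e+s≡r ⟩
          φ trim i (suc r) + T s          ≤⟨ +-monoˡ-≤ (T s) (φ-trim≤ i (suc r) (trans (+-suc i r) i+r≡N)) ⟩
          T N + T s                       ≡⟨ cong (_+ T s) (room-fills i r i+r≡N) ⟨
          φ trim i 1 + room i + T r + T s ≡⟨ cong (λ x → φ trim i 1 + x + T r + T s) (m≥n⇒m⊓n≡n room≤b) ⟨
          φ trim i 1 + trim i + T r + T s ≡⟨ swap (φ trim i 1 + trim i) (T r) (T s) ⟩
          X + T r                         ∎)

    -- Restoring the excess to a choice of value `T N` and lengthening its last gap by one gives at
    -- least `T N + excess i + r`. Hall's condition bounds this by `N + T N`, where `N = i + r`.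
    excess≤ : φ b N 1 ≤ T (suc N) → ∀ i → i ≤ N → excess i ≤ i
    excess≤ hall i i≤N = +-cancelʳ-≤ (r + T N) _ _ (begin
      excess i + (r + T N)               ≡⟨ lemma (excess i) r (T N) ⟩
      r + (T N + excess i)               ≤⟨ +-monoʳ-≤ r (+-monoˡ-≤ (excess i) (φ-trim≥ i r i+r≡N)) ⟩
      r + (φ trim i r + excess i)        ≤⟨ +-monoʳ-≤ r (φ-excess i r (≤-reflexive i+r≡N)) ⟩
      r + φ b i r                        ≤⟨ φ-grow b i r ⟩
      φ b i (suc r)                      ≡⟨ cong (φ b i) (+-comm 1 r) ⟩
      φ b i (r + 1)                      ≤⟨ φ-shift b i r 1 ⟩
      φ b (r + i) 1                      ≡⟨ cong (λ x → φ b x 1) (trans (+-comm r i) i+r≡N) ⟩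
      φ b N 1                            ≤⟨ hall ⟩
      N + T N                            ≡⟨ cong (_+ T N) i+r≡N ⟨
      i + r + T N                        ≡⟨ +-assoc i r (T N) ⟩
      i + (r + T N)                      ∎)
      where
      open ≤-Reasoning
      r : ℕ
      r = N ∸ i
      i+r≡N : i + r ≡ N
      i+r≡N = m+[n∸m]≡n i≤N
      lemma : ∀ x y z → x + (y + z) ≡ y + (z + x)
      lemma = solve-∀

  -- A matching that covers the demand: unit `t` of the demand at `i` gets the interval from
  -- `left i t` to `right i t`. Plain natural numbers let the induction change `n` and `b` freely.
  record Assignment (n : ℕ) (b : ℕ → ℕ) : Set where
    field
      left right : ℕ → ℕ → ℕ
      left≤  : ∀ {i t} → i < n → t < b i → left i t ≤ i
      ≤right : ∀ {i t} → i < n → t < b i → i ≤ right i t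
      right< : ∀ {i t} → i < n → t < b i → right i t < n
      unique : ∀ {i t i′ t′} → i < n → t < b i → i′ < n → t′ < b i′ →
               left i t ≡ left i′ t′ → right i t ≡ right i′ t′ → i ≡ i′ × t ≡ t′

  module Extend (b : ℕ → ℕ) (n : ℕ) (hall : φ b (suc n) 1 ≤ T (suc (suc n)))
                (rest : Assignment n (Trim.trim b (suc n))) where
    open Trim b (suc n)
    module rest = Assignment rest

    -- No interval that ends before `n` contains `n`; accordingly the empty choice already uses up
    -- `T (suc n)` and `room n` is 0.
    trim-last : trim n ≡ 0
    trim-last = n≤0⇒n≡0 (begin
      trim n                               ≤⟨ m⊓n≤n (b n) _ ⟩
      room n                               ≡⟨ room-eq n 0 (+-identityʳ (suc n)) ⟩
      T (suc n) ∸ (φ trim n 1 + 0)         ≤⟨ ∸-monoʳ-≤ (T (suc n)) (≤-trans (φ-trim≥ n 1 (+-comm n 1)) (m≤m+n _ 0)) ⟩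
      T (suc n) ∸ T (suc n)                ≡⟨ n∸n≡0 (T (suc n)) ⟩
      0                                    ∎)
      where open ≤-Reasoning

    old : ∀ {i t} → i < suc n → t < trim i → i < n
    old {i} (s≤s i≤n) t< with m≤n⇒m<n∨m≡n i≤n
    ... | inj₁ i<n  = i<n
    ... | inj₂ refl = contradiction (subst (_ <_) trim-last t<) λ ()

    -- The intervals ending at n are handed out in order of their left end.
    rank : ℕ → ℕ → ℕ
    rank i t = excess i + (t ∸ trim i)

    rank< : ∀ {i t} → trim i ≤ t → t < b i → rank i t < excess (suc i)
    rank< {i} trim≤t t<b = +-monoʳ-< (excess i) (∸-monoˡ-< t<b trim≤t)

    excess-mono : ∀ {i j} → i ≤ j → excess i ≤ excess j
    excess-mono {j = zero}  z≤n = ≤-refl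
    excess-mono {j = suc j} i≤1+j with m≤n⇒m<n∨m≡n i≤1+j
    ... | inj₁ (s≤s i≤j) = ≤-trans (excess-mono i≤j) (m≤m+n _ _)
    ... | inj₂ refl      = ≤-refl

    rank-< : ∀ {i t i′ t′} → trim i ≤ t → t < b i → i < i′ → rank i t < rank i′ t′
    rank-< {i′ = i′} ≤t t< i<i′ = <-≤-trans (rank< ≤t t<) (≤-trans (excess-mono i<i′) (m≤m+n (excess i′) _))

    rank-injective : ∀ {i t i′ t′} → trim i ≤ t → t < b i → trim i′ ≤ t′ → t′ < b i′ →
                     rank i t ≡ rank i′ t′ → i ≡ i′ × t ≡ t′
    rank-injective {i} {t} {i′} {t′} ≤t t< ≤t′ t′< eq with <-cmp i i′
    ... | tri< i<i′ _ _ = contradiction eq (<⇒≢ (rank-< ≤t t< i<i′))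
    ... | tri> _ _ i′<i = contradiction (sym eq) (<⇒≢ (rank-< ≤t′ t′< i′<i))
    ... | tri≈ _ refl _ = refl , ∸-cancelʳ-≡ ≤t ≤t′ (+-cancelˡ-≡ (excess i) _ _ eq)

    left right : ℕ → ℕ → ℕ
    left i t with t <? trim i
    ... | yes _ = rest.left i t
    ... | no  _ = rank i t
    right i t with t <? trim i
    ... | yes _ = rest.right i t
    ... | no  _ = n

    extended : Assignment (suc n) b
    extended = record
      { left = left ; right = right
      ; left≤ = left≤ ; ≤right = ≤right ; right< = right< ; unique = unique }
      where
      left≤ : ∀ {i t} → i < suc n → t < b i → left i t ≤ i
      left≤ {i} {t} i< t< with t <? trim i
      ... | yes p = rest.left≤ (old i< p) p
      -- The rank is below `excess (suc i)`, hence at most `i`, so the interval from it to `n`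
      -- contains `i`.
      ... | no ¬p = ≤-pred (≤-trans (rank< (≮⇒≥ ¬p) t<) (excess≤ hall (suc i) i<))
      ≤right : ∀ {i t} → i < suc n → t < b i → i ≤ right i t
      ≤right {i} {t} i< t< with t <? trim i
      ... | yes p = rest.≤right (old i< p) p
      ... | no ¬p = ≤-pred i<
      right< : ∀ {i t} → i < suc n → t < b i → right i t < suc n
      right< {i} {t} i< t< with t <? trim i
      ... | yes p = m<n⇒m<1+n (rest.right< (old i< p) p)
      ... | no ¬p = ≤-refl
      unique : ∀ {i t i′ t′} → i < suc n → t < b i → i′ < suc n → t′ < b i′ →
               left i t ≡ left i′ t′ → right i t ≡ right i′ t′ → i ≡ i′ × t ≡ t′
      unique {i} {t} {i′} {t′} i< t< i′< t′< eqˡ eqʳ with t <? trim i | t′ <? trim i′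
      ... | yes p | yes q = rest.unique (old i< p) p (old i′< q) q eqˡ eqʳ
      ... | yes p | no  _ = contradiction eqʳ (<⇒≢ (rest.right< (old i< p) p))
      ... | no  _ | yes q = contradiction (sym eqʳ) (<⇒≢ (rest.right< (old i′< q) q))
      ... | no ¬p | no ¬q = rank-injective (≮⇒≥ ¬p) t< (≮⇒≥ ¬q) t′< eqˡ

  assignment : ∀ n b → φ b n 1 ≤ T (suc n) → Assignment n b
  assignment zero    b _    = record
    { left = λ _ _ → 0 ; right = λ _ _ → 0
    ; left≤ = λ () ; ≤right = λ () ; right< = λ () ; unique = λ () }
  assignment (suc n) b hall = Extend.extended b n hall
    (assignment n trim (φ-trim≤ n 1 (+-comm n 1)))
    where open Trim b (suc n)

-- From admissible sequences to matchings.

module Necessity where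

  open Hall
  open import Defs

  import Data.Integer as ℤ
  import Data.Integer.Properties as ℤ
  open import Data.Fin as Fin using (Fin; toℕ; fromℕ<; punchIn)
  open import Data.Fin.Properties as Fin
    using (toℕ<n; toℕ-injective; any?; punchIn-injective; injective⇒≤; fromℕ<-toℕ; fromℕ<-injective; toℕ-fromℕ<)
  open import Data.Fin.Permutation using (Permutation′; _⟨$⟩ʳ_; _⟨$⟩ˡ_; inverseˡ)
  open import Data.List using (applyUpTo)
  open import Data.List.Properties using (length-applyUpTo)
  open import Data.List.Membership.Propositional using (_∈_; _∉_)
  open import Data.List.Membership.Propositional.Properties using (∈-applyUpTo⁺)
  open import Data.List.Relation.Unary.Unique.Propositional.Properties using (applyUpTo⁺₁)
  open import Data.Nat
  open import Data.Nat.Properties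
  open import Data.Product using (∃; _,_; proj₁; proj₂)
  open import Function using (_∘_; Injective)
  open import Relation.Nullary using (yes; no; contradiction)
  open import Relation.Binary.PropositionalEquality
  open import Algebra.Properties.CommutativeMonoid.Sum +-0-commutativeMonoid
    using (sum; sum-cong-≗; sum-remove; sum-permute; ∑-distrib-+)

  psum : ∀ {k} → (Fin k → ℕ) → ℕ → ℕ
  psum {zero}  g m       = 0
  psum {suc k} g zero    = 0
  psum {suc k} g (suc m) = g Fin.zero + psum (g ∘ Fin.suc) m

  psum-ℤ : ∀ {k} (g : Fin k → ℕ) m → prefixSum (ℤ.+_ ∘ g) m ≡ ℤ.+ psum g m
  psum-ℤ {zero}  g m       = refl
  psum-ℤ {suc k} g zero    = refl
  psum-ℤ {suc k} g (suc m) = cong (ℤ._+_ (ℤ.+ g Fin.zero)) (psum-ℤ (g ∘ Fin.suc) m)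

  psum-zero : ∀ {k} (g : Fin k → ℕ) → psum g 0 ≡ 0
  psum-zero {zero}  g = refl
  psum-zero {suc k} g = refl

  psum-sum : ∀ {k s} (g : Fin k → ℕ) (s≤k : s ≤ k) → psum g s ≡ sum (λ (j : Fin s) → g (Fin.inject≤ j s≤k))
  psum-sum {k}     {zero}  g z≤n       = psum-zero g
  psum-sum {suc k} {suc s} g (s≤s s≤k) = cong (g Fin.zero +_) (psum-sum (g ∘ Fin.suc) s≤k)

  large-value : ∀ {s} (g : Fin (suc s) → ℕ) → Injective _≡_ _≡_ g → ∃ λ j → s ≤ g j
  large-value {s} g g-inj with any? (λ j → s ≤? g j)
  ... | yes found = found
  ... | no  ¬found = contradiction (injective⇒≤ {f = λ j → fromℕ< (small j)} squeeze) 1+n≰n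
    where
    small : ∀ j → g j < s
    small j = ≰⇒> (λ s≤gj → ¬found (j , s≤gj))
    squeeze : Injective _≡_ _≡_ (λ j → fromℕ< (small j))
    squeeze eq = g-inj (fromℕ<-injective _ _ (small _) (small _) eq)

  T≤sum : ∀ s (g : Fin s → ℕ) → Injective _≡_ _≡_ g → T s ≤ sum g
  T≤sum zero    g g-inj = z≤n
  T≤sum (suc s) g g-inj with large-value g g-inj
  ... | j , s≤gj = begin
    s + T s                       ≤⟨ +-mono-≤ s≤gj (T≤sum s (g ∘ punchIn j) (punchIn-injective j _ _ ∘ g-inj)) ⟩
    g j + sum (g ∘ punchIn j)     ≡⟨ sum-remove g ⟨
    sum g                         ∎
    where open ≤-Reasoning

  T≤window : ∀ {k} m s (g : Fin k → ℕ) → Injective _≡_ _≡_ g → m + s ≤ k → psum g m + T s ≤ psum g (m + s)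
  T≤window zero s g g-inj s≤k = begin
    psum g 0 + T s                               ≡⟨ cong (_+ T s) (psum-zero g) ⟩
    T s                                          ≤⟨ T≤sum s _ (Fin.inject≤-injective s≤k s≤k _ _ ∘ g-inj) ⟩
    sum (λ j → g (Fin.inject≤ j s≤k))            ≡⟨ psum-sum g s≤k ⟨
    psum g s                                     ∎
    where open ≤-Reasoning
  T≤window {suc k} (suc m) s g g-inj (s≤s m+s≤k) = begin
    g Fin.zero + psum (g ∘ Fin.suc) m + T s      ≡⟨ +-assoc (g Fin.zero) _ _ ⟩
    g Fin.zero + (psum (g ∘ Fin.suc) m + T s)    ≤⟨ +-monoʳ-≤ (g Fin.zero) (T≤window m s (g ∘ Fin.suc) (Fin.suc-injective ∘ g-inj) m+s≤k) ⟩
    g Fin.zero + psum (g ∘ Fin.suc) (m + s)      ∎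
    where open ≤-Reasoning

  sum-one : ∀ k → sum {k} (λ _ → 1) ≡ k
  sum-one zero    = refl
  sum-one (suc k) = cong suc (sum-one k)

  sum-toℕ : ∀ k → sum {k} toℕ ≡ T k
  sum-toℕ zero    = refl
  sum-toℕ (suc k) = trans (∑-distrib-+ {k} (λ _ → 1) toℕ) (cong₂ _+_ (sum-one k) (sum-toℕ k))

  psum-permutation : ∀ {k} (π : Permutation′ k) → psum (λ j → toℕ (π ⟨$⟩ʳ j)) k ≡ T k
  psum-permutation {k} π = begin
    psum (λ j → toℕ (π ⟨$⟩ʳ j)) k                        ≡⟨ psum-sum (λ j → toℕ (π ⟨$⟩ʳ j)) ≤-refl ⟩
    sum (λ (j : Fin k) → toℕ (π ⟨$⟩ʳ Fin.inject≤ j ≤-refl)) ≡⟨ sum-cong-≗ (λ j → cong (λ x → toℕ (π ⟨$⟩ʳ x)) (Fin.inject≤-refl j ≤-refl)) ⟩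
    sum (λ (j : Fin k) → toℕ (π ⟨$⟩ʳ j))                 ≡⟨ sum-permute toℕ π ⟨
    sum {k} toℕ                                          ≡⟨ sum-toℕ k ⟩
    T k                                                  ∎
    where open ≡-Reasoning

  -- A grasshopper with jumps 0, …, k-1 that avoids [φ b i 1, φ b i 1 + b i) at
  -- each landing stays above φ, since s distinct jumps cover at least T s.
  φ≤psum : ∀ {K} b (g : Fin (suc K) → ℕ) → Injective _≡_ _≡_ g →
           (∀ i → i < K → φ b i 1 ≤ psum g (suc i) → φ b i 1 + b i ≤ psum g (suc i)) →
           ∀ i s → i ≤ K → i + s ≤ suc K → φ b i s ≤ psum g (i + s)
  φ≤psum b g g-inj avoids zero    s _ s≤k = T≤window 0 s g g-inj s≤k
  φ≤psum {K} b g g-inj avoids (suc i) s i<K i+s≤k = ⊔-lub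
    (subst (λ x → φ b i (suc s) ≤ psum g x) (+-suc i s)
      (φ≤psum b g g-inj avoids i (suc s) i≤K (subst (_≤ suc K) (sym (+-suc i s)) i+s≤k)))
    (begin
      φ b i 1 + b i + T s        ≤⟨ +-monoˡ-≤ (T s) (avoids i i<K above) ⟩
      psum g (suc i) + T s       ≤⟨ T≤window (suc i) s g g-inj i+s≤k ⟩
      psum g (suc i + s)         ∎)
    where
    open ≤-Reasoning
    i≤K : i ≤ K
    i≤K = ≤-trans (n≤1+n i) i<K
    above : φ b i 1 ≤ psum g (suc i)
    above = subst (λ x → φ b i 1 ≤ psum g x) (+-comm i 1)
      (φ≤psum b g g-inj avoids i 1 i≤K (subst (_≤ suc K) (+-comm 1 i) (m≤n⇒m≤1+n i<K)))

  extend : ∀ {K} → (Fin K → ℕ) → ℕ → ℕ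
  extend {K} b i with i <? K
  ... | yes i<K = b (fromℕ< i<K)
  ... | no  _   = 0

  extend-toℕ : ∀ {K} (b : Fin K → ℕ) i → extend b (toℕ i) ≡ b i
  extend-toℕ {K} b i with toℕ i <? K
  ... | yes i<K = cong b (fromℕ<-toℕ i i<K)
  ... | no  i≮K = contradiction (toℕ<n i) i≮K

  admissible⇒φ≤T : ∀ K (b : Fin K → ℕ) → Admissible (suc K) b → φ (extend b) K 1 ≤ T (suc K)
  admissible⇒φ≤T K b admissible = begin
    φ b̂ K 1            ≤⟨ φ≤psum b̂ jumps jumps-inj avoids K 1 ≤-refl (≤-reflexive (+-comm K 1)) ⟩
    -- At `i = K` and `s = 1` the prefix takes in every jump, so its sum does not depend on the
    -- order.
    psum jumps (K + 1) ≡⟨ cong (psum jumps) (+-comm K 1) ⟩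
    psum jumps (suc K) ≡⟨ psum-permutation π ⟩
    T (suc K)          ∎
    where
    open ≤-Reasoning
    b̂ : ℕ → ℕ
    b̂ = extend b
    forbidden : (i : Fin K) → FinSetℤ (b i)
    forbidden i = applyUpTo f (b i)
                , applyUpTo⁺₁ f (b i) (λ t<u _ eq → <⇒≢ t<u (+-cancelˡ-≡ _ _ _ (ℤ.+-injective eq)))
                , length-applyUpTo f (b i)
      where
      f : ℕ → ℤ.ℤ
      f t = ℤ.+ (φ b̂ (toℕ i) 1 + t)
    answer : ∃ λ (π : Permutation′ (suc K)) → ∀ i →
             prefixSum (λ j → ℤ.+ toℕ (π ⟨$⟩ʳ j)) (suc (toℕ i)) ∉ proj₁ (forbidden i)
    answer = admissible (λ j → ℤ.+ toℕ j) (toℕ-injective ∘ ℤ.+-injective) forbidden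
    π : Permutation′ (suc K)
    π = proj₁ answer
    jumps : Fin (suc K) → ℕ
    jumps j = toℕ (π ⟨$⟩ʳ j)
    jumps-inj : Injective _≡_ _≡_ jumps
    jumps-inj {x} {y} eq = trans (sym (inverseˡ π)) (trans (cong (π ⟨$⟩ˡ_) (toℕ-injective eq)) (inverseˡ π))
    avoids-at : (i : Fin K) → φ b̂ (toℕ i) 1 ≤ psum jumps (suc (toℕ i)) →
                φ b̂ (toℕ i) 1 + b̂ (toℕ i) ≤ psum jumps (suc (toℕ i))
    avoids-at i x≤S = ≮⇒≥ λ S<x+b → contradiction (hit S<x+b) (proj₂ answer i)
      where
      S x : ℕ
      S = psum jumps (suc (toℕ i))
      x = φ b̂ (toℕ i) 1
      x+t≡S : x + (S ∸ x) ≡ S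
      x+t≡S = m+[n∸m]≡n x≤S
      hit : S < x + b̂ (toℕ i) → prefixSum (λ j → ℤ.+ jumps j) (suc (toℕ i)) ∈ proj₁ (forbidden i)
      hit S<x+b = subst (_∈ proj₁ (forbidden i))
        (trans (cong ℤ.+_ x+t≡S) (sym (psum-ℤ jumps (suc (toℕ i)))))
        (∈-applyUpTo⁺ _ (+-cancelˡ-< x _ _ (subst₂ _<_ (sym x+t≡S) (cong (x +_) (extend-toℕ b i)) S<x+b)))
    avoids : ∀ i → i < K → φ b̂ i 1 ≤ psum jumps (suc i) → φ b̂ i 1 + b̂ i ≤ psum jumps (suc i)
    avoids i i<K = subst (λ i → φ b̂ i 1 ≤ psum jumps (suc i) → φ b̂ i 1 + b̂ i ≤ psum jumps (suc i))
      (toℕ-fromℕ< i<K) (avoids-at (fromℕ< i<K))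

  assignment⇒matching : ∀ K (b : Fin K → ℕ) → Assignment K (extend b) → MatchingSequence (suc K) b
  assignment⇒matching K b assigned = match , match-injective , adjacent
    where
    open Assignment assigned
    valid : ∀ i (t : Fin (b i)) → toℕ t < extend b (toℕ i)
    valid i t = subst (toℕ t <_) (sym (extend-toℕ b i)) (toℕ<n t)
    l< : ∀ i (t : Fin (b i)) → right (toℕ i) (toℕ t) < K
    l< i t = right< (toℕ<n i) (valid i t)
    j≤i : ∀ i (t : Fin (b i)) → left (toℕ i) (toℕ t) ≤ toℕ i
    j≤i i t = left≤ (toℕ<n i) (valid i t)
    j< : ∀ i (t : Fin (b i)) → left (toℕ i) (toℕ t) < K
    j< i t = ≤-<-trans (j≤i i t) (toℕ<n i)
    adjacentˡ : ∀ i t → toℕ (fromℕ< (j< i t)) ≤ toℕ i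
    adjacentˡ i t = subst (_≤ toℕ i) (sym (toℕ-fromℕ< (j< i t))) (j≤i i t)
    adjacentʳ : ∀ i t → toℕ i ≤ toℕ (fromℕ< (l< i t))
    adjacentʳ i t = subst (toℕ i ≤_) (sym (toℕ-fromℕ< (l< i t))) (≤right (toℕ<n i) (valid i t))
    match : Lower K b → Upper K
    match (i , t) = (fromℕ< (j< i t) , fromℕ< (l< i t)) , ≤-trans (adjacentˡ i t) (adjacentʳ i t)
    adjacent : (d : Lower K b) → Adjacent {b = b} (match d) d
    adjacent (i , t) = adjacentˡ i t , adjacentʳ i t
    match-injective : Injective _≡_ _≡_ match
    match-injective {i , t} {i′ , t′} eq with unique (toℕ<n i) (valid i t) (toℕ<n i′) (valid i′ t′)
        (fromℕ<-injective _ _ (j< i t) (j< i′ t′) (cong (proj₁ ∘ proj₁) eq))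
        (fromℕ<-injective _ _ (l< i t) (l< i′ t′) (cong (proj₂ ∘ proj₁) eq))
    ... | i≡ , t≡ with refl ← toℕ-injective i≡ = cong (i ,_) (toℕ-injective t≡)

  admissible⇒matching : ∀ K (b : Fin K → ℕ) → Admissible (suc K) b → MatchingSequence (suc K) b
  admissible⇒matching K b = assignment⇒matching K b ∘ assignment K (extend b) ∘ admissible⇒φ≤T K b

-- Alternating sums as sums of mixed differences.

module Alternation where

  open import Data.Integer using (ℤ; 0ℤ; 1ℤ; _+_; _-_; _≤_; _<_; +<+; +[1+_]) renaming (suc to sucℤ; +_ to pos; -_ to neg)
  open import Data.Integer.Properties
    using (≤-refl; <-trans; <-≤-trans; +-comm; +-identityˡ; +-identityʳ; +-monoˡ-<; +-monoʳ-<; i≤i+j; suc[i]≤j⇒i<j)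
  open import Data.Integer.Tactic.RingSolver using (solve-∀)
  open import Data.Nat using (ℕ; zero; suc)
  open import Data.Nat.Properties using (n<1+n)
  open import Data.Product using (∃; _×_; _,_)
  open import Data.Vec using (Vec; []; _∷_; foldr′)
  open import Function using (_∘_)
  open import Relation.Binary.PropositionalEquality

  private variable n : ℕ

  total : Vec ℤ n → ℤ
  total = foldr′ _+_ 0ℤ

  -- Laplace expansion: the alternating sum over the entries pulled out of w.
  expand : (ℤ → Vec ℤ n → ℤ) → Vec ℤ (suc n) → ℤ
  expand {zero}  K (x ∷ w) = K x w
  expand {suc n} K (x ∷ w) = K x w - expand (λ z v → K z (x ∷ v)) w

  -- The signed sum of `F` over all arrangements of `w`, built by repeated Laplace expansion.
  alternate : (Vec ℤ n → ℤ) → Vec ℤ n → ℤ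
  alternate {zero}  F w = F w
  alternate {suc n} F w = expand (λ x → alternate (F ∘ (x ∷_))) w

  -- The mixed difference of G over the unit cube at c.
  cube : (Vec ℤ n → ℤ) → Vec ℤ n → ℤ
  cube {zero}  G c       = G c
  cube {suc n} G (x ∷ c) = cube (G ∘ (sucℤ x ∷_)) c - cube (G ∘ (x ∷_)) c

  -- The mixed difference of G over the box [a₀,a₁] × [a₁,a₂] × ⋯.
  box : (Vec ℤ n → ℤ) → Vec ℤ (suc n) → ℤ
  box {zero}  G (x ∷ w)     = G w
  box {suc n} G (x ∷ y ∷ w) = box (G ∘ (y ∷_)) (y ∷ w) - box (G ∘ (x ∷_)) (y ∷ w)

  -- Pulling out an entry keeps the total, so agreement on one hyperplane of constant total is
  -- enough. This later allows a coordinate to be eliminated.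
  expand-cong : {K L : ℤ → Vec ℤ n → ℤ} (w : Vec ℤ (suc n)) →
                (∀ x v → x + total v ≡ total w → K x v ≡ L x v) → expand K w ≡ expand L w
  expand-cong {zero}  (x ∷ []) eq = eq x [] refl
  expand-cong {suc n} (x ∷ w)  eq = cong₂ _-_ (eq x w refl)
    (expand-cong w λ z v z+v≡w → eq z (x ∷ v) (trans (swap z x (total v)) (cong (x +_) z+v≡w)))
    where
    swap : ∀ a b c → a + (b + c) ≡ b + (a + c)
    swap = solve-∀

  alternate-cong : {F G : Vec ℤ n → ℤ} (w : Vec ℤ n) →
                   (∀ v → total v ≡ total w → F v ≡ G v) → alternate F w ≡ alternate G w
  alternate-cong {zero}  w eq = eq w refl
  alternate-cong {suc n} w eq = expand-cong w λ x v x+v≡w →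
    alternate-cong v λ u u≡v → eq (x ∷ u) (trans (cong (x +_) u≡v) x+v≡w)

  interchange : ∀ a b c d → (a - b) - (c - d) ≡ (a - c) - (b - d)
  interchange = solve-∀

  expand-sub : (K L : ℤ → Vec ℤ n → ℤ) (w : Vec ℤ (suc n)) →
               expand K w - expand L w ≡ expand (λ x v → K x v - L x v) w
  expand-sub {zero}  K L (x ∷ w) = refl
  expand-sub {suc n} K L (x ∷ w) = trans (interchange (K x w) _ (L x w) _)
    (cong (K x w - L x w -_) (expand-sub (λ z v → K z (x ∷ v)) (λ z v → L z (x ∷ v)) w))

  alternate-sub : (F G : Vec ℤ n → ℤ) (w : Vec ℤ n) →
                  alternate F w - alternate G w ≡ alternate (λ v → F v - G v) w
  alternate-sub {zero}  F G w = refl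
  alternate-sub {suc n} F G w = trans (expand-sub (λ x → alternate (F ∘ (x ∷_))) (λ x → alternate (G ∘ (x ∷_))) w)
    (expand-cong w λ x v _ → alternate-sub (F ∘ (x ∷_)) (G ∘ (x ∷_)) v)

  box-sub : (F G : Vec ℤ n → ℤ) (w : Vec ℤ (suc n)) → box F w - box G w ≡ box (λ v → F v - G v) w
  box-sub {zero}  F G (x ∷ w)     = refl
  box-sub {suc n} F G (x ∷ y ∷ w) = trans (interchange (box (F ∘ (y ∷_)) (y ∷ w)) _ (box (G ∘ (y ∷_)) (y ∷ w)) _)
    (cong₂ _-_ (box-sub (F ∘ (y ∷_)) (G ∘ (y ∷_)) (y ∷ w)) (box-sub (F ∘ (x ∷_)) (G ∘ (x ∷_)) (y ∷ w)))

  cube-sub : (F G : Vec ℤ n → ℤ) (c : Vec ℤ n) → cube F c - cube G c ≡ cube (λ v → F v - G v) c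
  cube-sub {zero}  F G c       = refl
  cube-sub {suc n} F G (x ∷ c) = trans (interchange (cube (F ∘ (sucℤ x ∷_)) c) _ (cube (G ∘ (sucℤ x ∷_)) c) _)
    (cong₂ _-_ (cube-sub (F ∘ (sucℤ x ∷_)) (G ∘ (sucℤ x ∷_)) c) (cube-sub (F ∘ (x ∷_)) (G ∘ (x ∷_)) c))

  -- Adjacent repetitions suffice: in each coordinate a corner of a `box` picks one of two
  -- neighbouring entries, so it can pick the same entry twice only in adjacent places.
  data Stutters : Vec ℤ n → Set where
    here  : ∀ x (w : Vec ℤ n) → Stutters (x ∷ x ∷ w)
    there : ∀ x {w : Vec ℤ n} → Stutters w → Stutters (x ∷ w)

  Alternating : (Vec ℤ n → ℤ) → Set
  Alternating G = ∀ {w} → Stutters w → G w ≡ 0ℤ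

  expand-zero : {K : ℤ → Vec ℤ n → ℤ} → (∀ x v → K x v ≡ 0ℤ) → ∀ w → expand K w ≡ 0ℤ
  expand-zero {zero}  K≡0 (x ∷ w) = K≡0 x w
  expand-zero {suc n} K≡0 (x ∷ w) = cong₂ _-_ (K≡0 x w) (expand-zero (λ z v → K≡0 z (x ∷ v)) w)

  x-x≡0 : ∀ x → x - x ≡ 0ℤ
  x-x≡0 = solve-∀

  -- The two terms that pull out either copy of a repeated entry cancel.
  expand-alternating : {K : ℤ → Vec ℤ n → ℤ} → (∀ x → Alternating (K x)) → Alternating (expand K)
  expand-alternating {suc zero}    {K} alt (here x []) = x-x≡0 (K x (x ∷ []))
  expand-alternating {suc (suc n)} {K} alt (here x w) = begin
    K x (x ∷ w) - (K x (x ∷ w) - expand (λ z v → K z (x ∷ x ∷ v)) w)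
      ≡⟨ cong (λ y → K x (x ∷ w) - (K x (x ∷ w) - y)) (expand-zero (λ z v → alt z (here x v)) w) ⟩
    K x (x ∷ w) - (K x (x ∷ w) - 0ℤ)
      ≡⟨ lemma (K x (x ∷ w)) ⟩
    0ℤ ∎
    where
    open ≡-Reasoning
    lemma : ∀ y → y - (y - 0ℤ) ≡ 0ℤ
    lemma = solve-∀
  expand-alternating {zero}  alt (there x ())
  expand-alternating {suc n} alt (there x s) =
    cong₂ _-_ (alt x s) (expand-alternating (λ z s′ → alt z (there x s′)) s)

  alternate-alternating : (F : Vec ℤ n → ℤ) → Alternating (alternate F)
  alternate-alternating {suc n} F = expand-alternating (λ x → alternate-alternating (F ∘ (x ∷_)))

  -- A corner of the box that repeats an entry contributes nothing; the other
  -- corners are a with one entry removed.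
  box-expand : {G : Vec ℤ n → ℤ} → Alternating G → ∀ w → box G w ≡ expand (λ _ → G) w
  box-expand {zero}      alt (x ∷ w)     = refl
  box-expand {suc n} {G} alt (x ∷ y ∷ w) = cong₂ _-_
    (trans (box-expand (alt ∘ there y) (y ∷ w)) (first G alt w))
    (box-expand (alt ∘ there x) (y ∷ w))
    where
    -- Pulling out the leading `y` leaves `G (y ∷ w)`; pulling out a later entry leaves `y` twice in
    -- a row, where `G` vanishes.
    first : ∀ {n} (G : Vec ℤ (suc n) → ℤ) → Alternating G → (w : Vec ℤ n) → expand (λ _ v → G (y ∷ v)) (y ∷ w) ≡ G (y ∷ w)
    first {zero}  G alt w = refl
    first {suc n} G alt w = trans (cong (G (y ∷ w) -_) (expand-zero (λ _ v → alt (here y v)) w)) (+-identityʳ _)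

  -- Every term of the expansion uses each entry of `c` exactly once, so shifting entries commutes
  -- with pulling one out.
  cube-expand : (K : ℤ → Vec ℤ n → ℤ) (c : Vec ℤ (suc n)) →
                cube (expand K) c ≡ expand (λ x v → cube (K (sucℤ x)) v - cube (K x) v) c
  cube-expand {zero}  K (x ∷ []) = refl
  cube-expand {suc n} K (x ∷ c)  = begin
    cube (expand K ∘ (sucℤ x ∷_)) c - cube (expand K ∘ (x ∷_)) c
      ≡⟨ cong₂ _-_ (cube-sub (K (sucℤ x)) (expand (K↑ (sucℤ x))) c) (cube-sub (K x) (expand (K↑ x)) c) ⟨
    (cube (K (sucℤ x)) c - cube (expand (K↑ (sucℤ x))) c) - (cube (K x) c - cube (expand (K↑ x)) c)
      ≡⟨ interchange (cube (K (sucℤ x)) c) _ (cube (K x) c) _ ⟩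
    (cube (K (sucℤ x)) c - cube (K x) c) - (cube (expand (K↑ (sucℤ x))) c - cube (expand (K↑ x)) c)
      ≡⟨ cong (cube (K (sucℤ x)) c - cube (K x) c -_)
           (trans (cong₂ _-_ (cube-expand (K↑ (sucℤ x)) c) (cube-expand (K↑ x) c))
           (trans (expand-sub (diff (sucℤ x)) (diff x) c)
                  (expand-cong c λ z v _ → interchange (cube (K (sucℤ z) ∘ (sucℤ x ∷_)) v) _ (cube (K (sucℤ z) ∘ (x ∷_)) v) _))) ⟩
    (cube (K (sucℤ x)) c - cube (K x) c) - expand (λ z v → cube (K (sucℤ z)) (x ∷ v) - cube (K z) (x ∷ v)) c
      ∎
    where
    open ≡-Reasoning
    K↑ : ℤ → ℤ → Vec ℤ n → ℤ
    K↑ y z v = K z (y ∷ v)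
    diff : ℤ → ℤ → Vec ℤ n → ℤ
    diff y z v = cube (K↑ y (sucℤ z)) v - cube (K↑ y z) v

  cube-alternate : (F : Vec ℤ n → ℤ) (c : Vec ℤ n) → cube (alternate F) c ≡ alternate (cube F) c
  cube-alternate {zero}  F c = refl
  cube-alternate {suc n} F c = trans (cube-expand (λ x → alternate (F ∘ (x ∷_))) c)
    (expand-cong c λ x v _ → trans
      (cong₂ _-_ (cube-alternate (F ∘ (sucℤ x ∷_)) v) (cube-alternate (F ∘ (x ∷_)) v))
      (alternate-sub (cube (F ∘ (sucℤ x ∷_))) (cube (F ∘ (x ∷_))) v))

  -- Positivity over interlacing rows.

  data Increasing : Vec ℤ n → Set where
    []  : Increasing []
    [_] : ∀ x → Increasing (x ∷ [])
    _∷_ : ∀ {x y} {w : Vec ℤ n} → x < y → Increasing (y ∷ w) → Increasing (x ∷ y ∷ w)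

  -- Neighbouring rows of a Gelfand-Tsetlin pattern. With half-open conditions, `c` runs over the
  -- lower corners of the unit cubes that tile the box of `a`, and is strictly increasing.
  data Interlaces : Vec ℤ (suc n) → Vec ℤ n → Set where
    [_] : ∀ x → Interlaces (x ∷ []) []
    _∷_ : ∀ {x y c} {w : Vec ℤ n} {cs} → x ≤ c × c < y → Interlaces (y ∷ w) cs → Interlaces (x ∷ y ∷ w) (c ∷ cs)

  interlaces⇒increasing : {a : Vec ℤ (suc n)} {c : Vec ℤ n} → Interlaces a c → Increasing c
  interlaces⇒increasing [ x ] = []
  interlaces⇒increasing (_∷_ {c = c} _ [ _ ]) = [ c ]
  interlaces⇒increasing ((_ , c<y) ∷ ic@((y≤d , _) ∷ _)) = <-≤-trans c<y y≤d ∷ interlaces⇒increasing ic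

  telescope : (g : ℤ → ℤ) (x : ℤ) (m : ℕ) → (∀ z → x ≤ z → z < x + +[1+ m ] → g z < g (sucℤ z)) →
              g x < g (x + +[1+ m ])
  telescope g x zero    step = subst (λ z → g x < g z) (+-comm 1ℤ x) (step x ≤-refl (i<i+1 x))
    where
    i<i+1 : ∀ i → i < i + 1ℤ
    i<i+1 i = subst (i <_) (+-comm 1ℤ i) (suc[i]≤j⇒i<j ≤-refl)
  telescope g x (suc m) step = <-trans
    (telescope g x m λ z x≤z z< → step z x≤z (<-trans z< below))
    (subst (λ z → g (x + +[1+ m ]) < g z) top
      (step (x + +[1+ m ]) (i≤i+j x (+[1+ m ])) below))
    where
    below : x + +[1+ m ] < x + +[1+ suc m ]
    below = +-monoʳ-< x (+<+ (n<1+n _))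
    top : sucℤ (x + +[1+ m ]) ≡ x + +[1+ suc m ]
    top = lemma 1ℤ x +[1+ m ]
      where
      lemma : ∀ a b c → a + (b + c) ≡ b + (a + c)
      lemma = solve-∀

  0<j-i : ∀ {i j} → i < j → 0ℤ < j - i
  0<j-i {i} {j} i<j = subst (_< j - i) (x-x≡0 i) (+-monoˡ-< (neg i) i<j)

  <⇒gap : ∀ {x y} → x < y → ∃ λ m → y ≡ x + +[1+ m ]
  <⇒gap {x} {y} x<y with y - x | lemma x y | 0<j-i x<y
    where
    lemma : ∀ x y → y ≡ x + (y - x)
    lemma = solve-∀
  ... | +[1+ m ] | eq | _               = m , eq
  ... | pos zero | _  | +<+ ()

  -- The unit cubes tile the box, so its mixed difference is the sum of theirs. The sum is never
  -- written out: the coordinates telescope one after another.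
  box-positive : (G : Vec ℤ n → ℤ) {a : Vec ℤ (suc n)} → Increasing a →
                 (∀ c → Interlaces a c → 0ℤ < cube G c) → 0ℤ < box G a
  box-positive G [ x ] each = each [] [ x ]
  box-positive {suc n} G {x ∷ y ∷ w} (x<y ∷ inc) each = subst (0ℤ <_)
    (sym (box-sub (G ∘ (y ∷_)) (G ∘ (x ∷_)) (y ∷ w)))
    (box-positive (λ v → G (y ∷ v) - G (x ∷ v)) inc λ c ic → subst (0ℤ <_)
      (cube-sub (G ∘ (y ∷_)) (G ∘ (x ∷_)) c) (0<j-i (rise c ic)))
    where
    rise : ∀ c → Interlaces (y ∷ w) c → cube (G ∘ (x ∷_)) c < cube (G ∘ (y ∷_)) c
    rise c ic with <⇒gap x<y
    ... | m , refl = telescope (λ z → cube (G ∘ (z ∷_)) c) x m λ z x≤z z<y →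
      0<j-i⇒i<j (each (z ∷ c) ((x≤z , z<y) ∷ ic))
      where
      0<j-i⇒i<j : ∀ {i j} → 0ℤ < j - i → i < j
      0<j-i⇒i<j {i} {j} 0<d = subst₂ _<_ (+-identityˡ i) (lemma j i) (+-monoˡ-< i 0<d)
        where
        lemma : ∀ j i → j - i + i ≡ j
        lemma = solve-∀

  -- Restriction to the hyperplane of total S: differences E_q - 1 of the slice are
  -- differences E_q - E_0 of F.
  slice : ℤ → (Vec ℤ (suc n) → ℤ) → Vec ℤ n → ℤ
  slice S F v = F ((S - total v) ∷ v)

  -- With E_p the shift of coordinate p by 1: on each hyperplane of constant total,
  -- the function ∏ (E_q - E_p) F, over all pairs p < q, is at least c.
  VandermondeBound : (Vec ℤ n → ℤ) → ℤ → Set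
  VandermondeBound {zero}  F c = c ≤ F []
  VandermondeBound {suc n} F c = ∀ S → VandermondeBound (cube (slice S F)) c

  -- The total of `a` determines the first coordinate from the others, so the outer expansion is
  -- that of the single function `alternate H`. This is a difference over the box of `a`, and on
  -- each of its unit cubes induction applies to `cube H`.
  alternate-positive : (F : Vec ℤ n → ℤ) → VandermondeBound F 1ℤ → ∀ {a} → Increasing a → 0ℤ < alternate F a
  alternate-positive {zero}  F bound []  = suc[i]≤j⇒i<j bound
  alternate-positive {suc n} F bound {a} inc = subst (0ℤ <_) (sym reduce)
    (box-positive (alternate H) inc λ c ic → subst (0ℤ <_) (sym (cube-alternate H c))
      (alternate-positive (cube H) (bound (total a)) (interlaces⇒increasing ic)))
    where
    open ≡-Reasoning
    H : Vec ℤ n → ℤ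
    H = slice (total a) F
    lemma : ∀ x t → x ≡ (x + t) - t
    lemma = solve-∀
    reduce : alternate F a ≡ box (alternate H) a
    reduce = begin
      alternate F a                ≡⟨ expand-cong a (λ x v x+v≡a → alternate-cong v λ u u≡v →
                                        cong (λ y → F (y ∷ u)) (trans (lemma x (total u))
                                          (cong (_- total u) (trans (cong (x +_) u≡v) x+v≡a)))) ⟩
      expand (λ _ → alternate H) a ≡⟨ box-expand (alternate-alternating H) a ⟨
      box (alternate H) a          ∎

-- The Vandermonde operator on products of linear forms.

module Products where

  open Alternation
  open import Data.Integer using (ℤ; 0ℤ; 1ℤ; _+_; _-_; _*_; _≤_; +≤+) renaming (suc to sucℤ)
  open import Data.Integer.Properties using (≤-refl; +-mono-≤; *-assoc; *-identityˡ; *-identityʳ; *-zeroʳ)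
  open import Data.Integer.Tactic.RingSolver using (solve-∀)
  open import Data.Fin using (Fin; zero; suc; toℕ)
  open import Data.List using (List; []; _∷_; _++_; map; length; allFin)
  open import Data.List.Properties using (map-tabulate; length-++)
  open import Data.List.Relation.Binary.Pointwise using (Pointwise; []; _∷_; ++⁺)
  open import Data.Nat as ℕ using (ℕ; zero; suc)
  import Data.Nat.Properties as ℕ
  open import Data.Product using (_×_; _,_; proj₁; proj₂)
  open import Data.Sum using (_⊎_; inj₁; inj₂)
  open import Data.Vec using (Vec; []; _∷_)
  open import Function using (_∘_; id)
  open import Relation.Binary.PropositionalEquality
  open import Relation.Nullary using (yes; no)

  private variable n : ℕ

  bump : Fin n → Vec ℤ n → Vec ℤ n
  bump zero    (x ∷ w) = sucℤ x ∷ w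
  bump (suc j) (x ∷ w) = x ∷ bump j w

  total-bump : (j : Fin n) (w : Vec ℤ n) → total (bump j w) ≡ sucℤ (total w)
  total-bump zero    (x ∷ w) = lemma 1ℤ x (total w)
    where
    lemma : ∀ a b c → a + b + c ≡ a + (b + c)
    lemma = solve-∀
  total-bump (suc j) (x ∷ w) = trans (cong (x +_) (total-bump j w)) (lemma x 1ℤ (total w))
    where
    lemma : ∀ a b c → a + (b + c) ≡ b + (a + c)
    lemma = solve-∀

  diff : Fin n → (Vec ℤ n → ℤ) → Vec ℤ n → ℤ
  diff j F w = F (bump j w) - F w

  diffs : List (Fin n) → (Vec ℤ n → ℤ) → Vec ℤ n → ℤ
  diffs []       F = F
  diffs (j ∷ js) F = diffs js (diff j F)

  diffs-suc : ∀ js (F : Vec ℤ (suc n) → ℤ) x w → diffs (map suc js) F (x ∷ w) ≡ diffs js (F ∘ (x ∷_)) w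
  diffs-suc []       F x w = refl
  diffs-suc (j ∷ js) F x w = diffs-suc js (diff (suc j) F) x w

  cube-diffs : (F : Vec ℤ n → ℤ) (w : Vec ℤ n) → cube F w ≡ diffs (allFin n) F w
  cube-diffs {zero}  F w       = refl
  cube-diffs {suc n} F (x ∷ w) = begin
    cube (F ∘ (sucℤ x ∷_)) w - cube (F ∘ (x ∷_)) w   ≡⟨ cube-sub (F ∘ (sucℤ x ∷_)) (F ∘ (x ∷_)) w ⟩
    cube (diff zero F ∘ (x ∷_)) w                    ≡⟨ cube-diffs (diff zero F ∘ (x ∷_)) w ⟩
    diffs (allFin n) (diff zero F ∘ (x ∷_)) w        ≡⟨ diffs-suc (allFin n) (diff zero F) x w ⟨
    diffs (map suc (allFin n)) (diff zero F) (x ∷ w) ≡⟨ cong (λ js → diffs js (diff zero F) (x ∷ w)) (map-tabulate id suc) ⟩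
    diffs (allFin (suc n)) F (x ∷ w)                 ∎
    where open ≡-Reasoning

  cube-cong : {F G : Vec ℤ n → ℤ} → F ≗ G → cube F ≗ cube G
  cube-cong {zero}  eq w       = eq w
  cube-cong {suc n} eq (x ∷ w) = cong₂ _-_ (cube-cong (eq ∘ (sucℤ x ∷_)) w) (cube-cong (eq ∘ (x ∷_)) w)

  sub-add : ∀ a b c d → (a + b) - (c + d) ≡ (a - c) + (b - d)
  sub-add = solve-∀

  cube-add : (F G : Vec ℤ n → ℤ) → cube (λ w → F w + G w) ≗ (λ w → cube F w + cube G w)
  cube-add {zero}  F G w       = refl
  cube-add {suc n} F G (x ∷ w) = trans
    (cong₂ _-_ (cube-add (F ∘ (sucℤ x ∷_)) (G ∘ (sucℤ x ∷_)) w) (cube-add (F ∘ (x ∷_)) (G ∘ (x ∷_)) w))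
    (sub-add (cube (F ∘ (sucℤ x ∷_)) w) _ _ _)

  cube-0 : (w : Vec ℤ n) → cube (λ _ → 0ℤ) w ≡ 0ℤ
  cube-0 {zero}  w       = refl
  cube-0 {suc n} (x ∷ w) = cong₂ _-_ (cube-0 w) (cube-0 w)

  bound-cong : ∀ {F G : Vec ℤ n → ℤ} {c} → F ≗ G → VandermondeBound F c → VandermondeBound G c
  bound-cong {zero}  eq bound   = subst (_ ≤_) (eq []) bound
  bound-cong {suc n} eq bound S = bound-cong (cube-cong (λ v → eq _)) (bound S)

  bound-+ : ∀ {F G : Vec ℤ n → ℤ} {c d} → VandermondeBound F c → VandermondeBound G d →
            VandermondeBound (λ w → F w + G w) (c + d)
  bound-+ {zero}          p q   = +-mono-≤ p q
  bound-+ {suc n} {F} {G} p q S = bound-cong (λ w → sym (cube-add (slice S F) (slice S G) w)) (bound-+ (p S) (q S))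

  bound-0 : VandermondeBound {n} (λ _ → 0ℤ) 0ℤ
  bound-0 {zero}    = ≤-refl
  bound-0 {suc n} S = bound-cong (λ w → sym (cube-0 w)) bound-0

  diffs-cong : ∀ js {F G : Vec ℤ n → ℤ} → F ≗ G → diffs js F ≗ diffs js G
  diffs-cong []       eq = eq
  diffs-cong (j ∷ js) eq = diffs-cong js (λ w → cong₂ _-_ (eq (bump j w)) (eq w))

  diffs-add : ∀ js (F G : Vec ℤ n → ℤ) → diffs js (λ w → F w + G w) ≗ (λ w → diffs js F w + diffs js G w)
  diffs-add []       F G w = refl
  diffs-add (j ∷ js) F G w = trans
    (diffs-cong js (λ v → sub-add (F (bump j v)) (G (bump j v)) (F v) (G v)) w)
    (diffs-add js (diff j F) (diff j G) w)

  diffs-0 : ∀ js (w : Vec ℤ n) → diffs js (λ _ → 0ℤ) w ≡ 0ℤ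
  diffs-0 []       w = refl
  diffs-0 (j ∷ js) w = diffs-0 js w

  step : ℕ → ℕ → ℤ
  step zero    i       = 1ℤ
  step (suc x) zero    = 0ℤ
  step (suc x) (suc i) = step x i

  step-≤ : ∀ {x i} → x ℕ.≤ i → step x i ≡ 1ℤ
  step-≤ ℕ.z≤n     = refl
  step-≤ (ℕ.s≤s p) = step-≤ p

  step-> : ∀ {x i} → i ℕ.< x → step x i ≡ 0ℤ
  step-> {suc x} {zero}  _         = refl
  step-> {suc x} {suc i} (ℕ.s≤s p) = step-> p

  Covers : ℕ × ℕ → ℕ → Set
  Covers (j , l) i = j ℕ.≤ i × i ℕ.≤ l

  -- The indicator of `o ≤ i ≤ o + p`, as `step x i` is that of `x ≤ i`.
  slope : ℕ → ℕ → ℕ → ℤ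
  slope o p i = step o i - step (suc (o ℕ.+ p)) i

  slope-covers : ∀ {o p i} → Covers (o , o ℕ.+ p) i → slope o p i ≡ 1ℤ
  slope-covers (o≤i , i≤o+p) = cong₂ _-_ (step-≤ o≤i) (step-> (ℕ.s≤s i≤o+p))

  slope-cases : ∀ o p i → slope o p i ≡ 1ℤ ⊎ slope o p i ≡ 0ℤ
  slope-cases o p i with o ℕ.≤? i | i ℕ.≤? o ℕ.+ p
  ... | yes o≤i | yes i≤o+p = inj₁ (slope-covers {p = p} (o≤i , i≤o+p))
  ... | yes o≤i | no  i≰o+p = inj₂ (cong₂ _-_ (step-≤ o≤i) (step-≤ (ℕ.≰⇒> i≰o+p)))
  ... | no  o≰i | _         = inj₂ (cong₂ _-_ (step-> (ℕ.≰⇒> o≰i)) (step-> (ℕ.m<n⇒m<1+n (ℕ.m≤n⇒m≤n+o p (ℕ.≰⇒> o≰i)))))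

  slope-shift : ∀ o p i → slope o (suc p) i - slope o 0 i ≡ slope (suc o) p i
  slope-shift o p i rewrite ℕ.+-suc o p | ℕ.+-identityʳ o = lemma (step o i) _ _
    where
    lemma : ∀ a b c → (a - b) - (a - c) ≡ c - b
    lemma = solve-∀

  -- The partial sum after i jumps, up to sign and modulo the total, once slicing
  -- has eliminated o coordinates.
  record Form (o i : ℕ) (ℓ : Vec ℤ n → ℤ) : Set where
    constructor affine
    field bumped : ∀ j w → ℓ (bump j w) ≡ ℓ w + slope o (toℕ j) i

  open Form

  form-bump : ∀ {o i} {ℓ : Vec ℤ n → ℤ} j → Form o i ℓ → Form o i (ℓ ∘ bump j)
  form-bump {o = o} {i} {ℓ} j form = affine λ j′ w → begin
    ℓ (bump j (bump j′ w))                        ≡⟨ bumped form j (bump j′ w) ⟩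
    ℓ (bump j′ w) + slope o (toℕ j) i             ≡⟨ cong (_+ slope o (toℕ j) i) (bumped form j′ w) ⟩
    ℓ w + slope o (toℕ j′) i + slope o (toℕ j) i  ≡⟨ lemma (ℓ w) _ _ ⟩
    ℓ w + slope o (toℕ j) i + slope o (toℕ j′) i  ≡⟨ cong (_+ slope o (toℕ j′) i) (bumped form j w) ⟨
    ℓ (bump j w) + slope o (toℕ j′) i             ∎
    where
    open ≡-Reasoning
    lemma : ∀ a b c → a + b + c ≡ a + c + b
    lemma = solve-∀

  -- On a slice, raising coordinate `j` raises coordinate `suc j` of the full vector and lowers its
  -- coordinate 0. The slopes subtract, which removes the point `o` from an interval that starts
  -- there.
  form-slice : ∀ {o i} {ℓ : Vec ℤ (suc n) → ℤ} S → Form o i ℓ → Form (suc o) i (slice S ℓ)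
  form-slice {n} {o} {i} {ℓ} S form = affine λ j v →
    let y = S - sucℤ (total v) in begin
    ℓ ((S - total (bump j v)) ∷ bump j v)                          ≡⟨ cong (λ t → ℓ ((S - t) ∷ bump j v)) (total-bump j v) ⟩
    ℓ (bump (suc j) (y ∷ v))                                       ≡⟨ bumped form (suc j) (y ∷ v) ⟩
    ℓ (y ∷ v) + slope o (suc (toℕ j)) i                            ≡⟨ lemma (ℓ (y ∷ v)) _ (slope o 0 i) ⟩
    ℓ (y ∷ v) + slope o 0 i + (slope o (suc (toℕ j)) i - slope o 0 i)
      ≡⟨ cong₂ _+_ (sym (bumped form zero (y ∷ v))) (slope-shift o (toℕ j) i) ⟩
    ℓ (sucℤ y ∷ v) + slope (suc o) (toℕ j) i                       ≡⟨ cong (λ x → ℓ (x ∷ v) + slope (suc o) (toℕ j) i) (y+1 1ℤ S (total v)) ⟩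
    ℓ ((S - total v) ∷ v) + slope (suc o) (toℕ j) i                ∎
    where
    open ≡-Reasoning
    lemma : ∀ a b c → a + b ≡ a + c + (b - c)
    lemma = solve-∀
    y+1 : ∀ a s t → a + (s - (a + t)) ≡ s - t
    y+1 = solve-∀

  prod : List (Vec ℤ n → ℤ) → Vec ℤ n → ℤ
  prod []       w = 1ℤ
  prod (ℓ ∷ ℓs) w = ℓ w * prod ℓs w

  prod-++ : ∀ (ℓs ms : List (Vec ℤ n → ℤ)) w → prod (ℓs ++ ms) w ≡ prod ℓs w * prod ms w
  prod-++ []       ms w = sym (*-identityˡ _)
  prod-++ (ℓ ∷ ℓs) ms w = trans (cong (ℓ w *_) (prod-++ ℓs ms w)) (sym (*-assoc (ℓ w) _ _))

  prod-map : ∀ {m} (h : Vec ℤ m → Vec ℤ n) ℓs w → prod (map (_∘ h) ℓs) w ≡ prod ℓs (h w)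
  prod-map h []       w = refl
  prod-map h (ℓ ∷ ℓs) w = cong (ℓ (h w) *_) (prod-map h ℓs w)

  Forms : ℕ → List ℕ → List (Vec ℤ n → ℤ) → Set
  Forms o = Pointwise (Form o)

  forms-bump : ∀ {o is} {ℓs : List (Vec ℤ n → ℤ)} j → Forms o is ℓs → Forms o is (map (_∘ bump j) ℓs)
  forms-bump j []                    = []
  forms-bump j (form ∷ fs) = form-bump j form ∷ forms-bump j fs

  forms-slice : ∀ {o is} {ℓs : List (Vec ℤ (suc n) → ℤ)} S → Forms o is ℓs → Forms (suc o) is (map (slice S) ℓs)
  forms-slice S []                    = []
  forms-slice S (form ∷ fs) = form-slice S form ∷ forms-slice S fs

  -- The discrete Leibniz rule: where the first factor is differenced, the later ones are shifted.
  diff-prod : ∀ {o i} {ℓ : Vec ℤ n → ℤ} → Form o i ℓ → ∀ ℓs j w →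
              diff j (prod (ℓ ∷ ℓs)) w ≡ slope o (toℕ j) i * prod (map (_∘ bump j) ℓs) w + ℓ w * diff j (prod ℓs) w
  diff-prod {o = o} {i} {ℓ} form ℓs j w = begin
    ℓ (bump j w) * P - ℓ w * prod ℓs w                ≡⟨ cong (λ x → x * P - ℓ w * prod ℓs w) (bumped form j w) ⟩
    (ℓ w + slope o (toℕ j) i) * P - ℓ w * prod ℓs w   ≡⟨ lemma (ℓ w) (slope o (toℕ j) i) P (prod ℓs w) ⟩
    slope o (toℕ j) i * P + ℓ w * (P - prod ℓs w)     ≡⟨ cong (λ x → slope o (toℕ j) i * x + ℓ w * (P - prod ℓs w)) (prod-map (bump j) ℓs w) ⟨
    slope o (toℕ j) i * prod (map (_∘ bump j) ℓs) w + ℓ w * (P - prod ℓs w) ∎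
    where
    open ≡-Reasoning
    P : ℤ
    P = prod ℓs (bump j w)
    lemma : ∀ a s p q → (a + s) * p - a * q ≡ s * p + a * (p - q)
    lemma = solve-∀

  -- Listed in the order in which `VandermondeBound` applies its operators: eliminating coordinate
  -- `o` leaves `n` differences, and difference `j` has the slope of the interval from `suc o` to
  -- `suc o + j`.
  intervals : ℕ → ℕ → List (ℕ × ℕ)
  intervalsAt : ℕ → List (Fin n) → List (ℕ × ℕ)
  intervalsAt o js = map (λ j → o , o ℕ.+ toℕ j) js
  intervals o zero    = []
  intervals o (suc n) = intervalsAt (suc o) (allFin n) ++ intervals (suc o) n

  Bounded : List (Fin n) → (Vec ℤ n → ℤ) → ℤ → Set
  Bounded js F = VandermondeBound (diffs js F)

  bounded-cong : ∀ js {F G : Vec ℤ n → ℤ} {c} → F ≗ G → Bounded js F c → Bounded js G c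
  bounded-cong js eq = bound-cong (diffs-cong js eq)

  bounded-+ : ∀ js {F G : Vec ℤ n → ℤ} {c d} → Bounded js F c → Bounded js G d → Bounded js (λ w → F w + G w) (c + d)
  bounded-+ js {F} {G} p q = bound-cong (λ w → sym (diffs-add js F G w)) (bound-+ p q)

  bounded-0 : ∀ (js : List (Fin n)) → Bounded js (λ _ → 0ℤ) 0ℤ
  bounded-0 js = bound-cong (λ w → sym (diffs-0 js w)) bound-0

  NonNegative : ℕ → List (Fin n) → ℕ → Set
  NonNegative o js d = ∀ {is ℓs} → Forms o is ℓs → length is ≡ d → Bounded js (prod ℓs) 0ℤ

  bounded-slope : ∀ o p i js {F : Vec ℤ n → ℤ} → Bounded js F 0ℤ → Bounded js (λ w → slope o p i * F w) 0ℤ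
  bounded-slope o p i js {F} bound with slope-cases o p i
  ... | inj₁ s≡1 = bounded-cong js (λ w → sym (trans (cong (_* F w) s≡1) (*-identityˡ _))) bound
  ... | inj₂ s≡0 = bounded-cong js (λ w → sym (cong (_* F w) s≡0)) (bounded-0 js)

  -- The Leibniz rule is iterated, with `ℓs` holding the factors already passed. Each term is a
  -- slope, 0 or 1, times a product of `d` forms, to which `nonneg` applies.
  diff-nonNegative : ∀ {o} js {d} → NonNegative {n} o js d → ∀ j {is ks ℓs ms} → Forms o is ℓs → Forms o ks ms →
                     length is ℕ.+ length ks ≡ suc d →
                     Bounded js (λ w → prod ℓs w * diff j (prod ms) w) 0ℤ
  diff-nonNegative js nonneg j {ℓs = ℓs} fs [] eq =
    bounded-cong js (λ w → sym (*-zeroʳ (prod ℓs w))) (bounded-0 js)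
  diff-nonNegative {o = o} js {d} nonneg j {is} {i ∷ ks} {ℓs} {m ∷ ms} fs (form ∷ gs) eq =
    bounded-cong js split
      (bounded-+ js
        (bounded-slope o (toℕ j) i js (nonneg {is ++ ks} {ℓs ++ map (_∘ bump j) ms}
          (++⁺ fs (forms-bump j gs)) (trans (length-++ is) (ℕ.suc-injective (trans (sym (ℕ.+-suc _ _)) eq)))))
        (diff-nonNegative js nonneg j (form ∷ fs) gs (trans (sym (ℕ.+-suc _ _)) eq)))
    where
    open ≡-Reasoning
    s : ℤ
    s = slope o (toℕ j) i
    lemma : ∀ p s q a r → s * (p * q) + a * p * r ≡ p * (s * q + a * r)
    lemma = solve-∀
    split : ∀ w → s * prod (ℓs ++ map (_∘ bump j) ms) w + prod (m ∷ ℓs) w * diff j (prod ms) w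
                ≡ prod ℓs w * diff j (prod (m ∷ ms)) w
    split w = begin
      s * prod (ℓs ++ map (_∘ bump j) ms) w + m w * prod ℓs w * D
        ≡⟨ cong (λ x → s * x + m w * prod ℓs w * D) (prod-++ ℓs (map (_∘ bump j) ms) w) ⟩
      s * (prod ℓs w * Q) + m w * prod ℓs w * D
        ≡⟨ lemma (prod ℓs w) s Q (m w) D ⟩
      prod ℓs w * (s * Q + m w * D)
        ≡⟨ cong (prod ℓs w *_) (diff-prod form ms j w) ⟨
      prod ℓs w * diff j (prod (m ∷ ms)) w ∎
      where
      Q D : ℤ
      Q = prod (map (_∘ bump j) ms) w
      D = diff j (prod ms) w

  -- Each factor E_q - E_p of the Vandermonde operator differentiates one linear
  -- factor of the product, with slope 1 or 0 according to whether the interval of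
  -- (p, q) covers the index of that factor.
  ProductBound : List (ℕ × ℕ) → List ℕ → (Vec ℤ n → ℤ) → Set
  ProductBound us is F = VandermondeBound F 0ℤ × (Pointwise Covers us is → VandermondeBound F 1ℤ)

  prod-bound  : ∀ o {is} {ℓs : List (Vec ℤ n → ℤ)} → Forms o is ℓs → length is ≡ length (intervals o n) →
                ProductBound (intervals o n) is (prod ℓs)
  diffs-bound : ∀ o js {is} {ℓs : List (Vec ℤ n → ℤ)} → Forms o is ℓs →
                length is ≡ length (intervalsAt o js ++ intervals o n) →
                ProductBound (intervalsAt o js ++ intervals o n) is (diffs js (prod ℓs))

  prod-bound {zero}  o [] eq = +≤+ ℕ.z≤n , λ _ → ≤-refl
  prod-bound {suc n} o {is} {ℓs} fs eq =
    (λ S → transfer S (proj₁ (sliced S))) , λ covers S → transfer S (proj₂ (sliced S) covers)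
    where
    sliced : ∀ S → ProductBound (intervals o (suc n)) is (diffs (allFin n) (prod (map (slice S) ℓs)))
    sliced S = diffs-bound (suc o) (allFin n) (forms-slice S fs) eq
    transfer : ∀ S {c} → VandermondeBound (diffs (allFin n) (prod (map (slice S) ℓs))) c →
               VandermondeBound (cube (slice S (prod ℓs))) c
    transfer S = bound-cong λ w → trans
      (diffs-cong (allFin n) (prod-map (λ v → (S - total v) ∷ v) ℓs) w)
      (sym (cube-diffs (slice S (prod ℓs)) w))

  diffs-bound o []       fs eq = prod-bound o fs eq
  -- Differencing the head factor pairs its index with the first interval, and all other terms are
  -- nonnegative. So the bound 1 comes from the diagonal term of the permanent.
  diffs-bound {n} o (j ∷ js) {i ∷ is} {ℓ ∷ ℓs} (form ∷ fs) eq =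
      bounded-cong js split (bounded-+ js (bounded-slope o (toℕ j) i js (proj₁ rest)) others)
    , λ { (covers ∷ cs) → bounded-cong js split (bounded-+ js
            (bounded-cong js (λ w → sym (trans (cong (_* _) (slope-covers {p = toℕ j} covers)) (*-identityˡ _))) (proj₂ rest cs)) others) }
    where
    rest : ProductBound (intervalsAt o js ++ intervals o n) is (diffs js (prod (map (_∘ bump j) ℓs)))
    rest = diffs-bound o js (forms-bump j fs) (ℕ.suc-injective eq)
    others : Bounded js (λ w → prod (ℓ ∷ []) w * diff j (prod ℓs) w) 0ℤ
    others = diff-nonNegative js (λ gs eq′ → proj₁ (diffs-bound o js gs eq′)) j (form ∷ []) fs eq
    split : ∀ w → slope o (toℕ j) i * prod (map (_∘ bump j) ℓs) w + prod (ℓ ∷ []) w * diff j (prod ℓs) w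
                ≡ diff j (prod (ℓ ∷ ℓs)) w
    split w = trans (cong (λ x → slope o (toℕ j) i * prod (map (_∘ bump j) ℓs) w + x * diff j (prod ℓs) w) (*-identityʳ (ℓ w))) (sym (diff-prod form ℓs j w))

-- From matchings to admissible sequences.

module Sufficiency where

  open import Defs
  open Alternation
  open Products
  open import Data.Integer using (ℤ; 0ℤ; 1ℤ; _+_; _-_; _*_; _≤_; _<_)
  open import Data.Integer.Properties
    using (≤-total; ≤∧≢⇒<; ≤-trans; ≤-refl; <-irrefl; *-zeroʳ; +-0-commutativeMonoid; _≟_)
  open import Data.Integer.Tactic.RingSolver using (solve-∀)
  open import Data.Fin using (Fin; zero; suc; toℕ; punchIn; cast; fromℕ<)
  open import Data.Fin.Permutation
    using (Permutation′; _⟨$⟩ʳ_; insert; insert-punchIn; _∘ₚ_) renaming (id to idₚ)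
  open import Data.Fin.Properties
    using (punchIn-injective; punchInᵢ≢i; any?; toℕ-injective; toℕ<n; toℕ-fromℕ<; cast-is-id; cast-trans)
  open import Data.List using (List; []; _∷_; map; length; allFin) renaming (lookup to lookupᴸ)
  open import Data.List.Properties using (length-map; map-id)
  open import Data.List.Membership.Propositional using (_∈_; _∉_)
  open import Data.List.Membership.Propositional.Properties using (∈-map⁺; ∈-++⁺ˡ; ∈-++⁺ʳ; ∈-allFin)
  open import Data.List.Relation.Binary.Pointwise using (Pointwise; []; _∷_)
  open import Data.List.Relation.Unary.All using (All; []; _∷_; universal) renaming (map to mapᴬ; lookup to lookupᴬ)
  open import Data.List.Relation.Unary.All.Properties using (++⁺; map⁺; map⁻)
  open import Data.List.Relation.Unary.Any using (index)
  open import Data.List.Relation.Unary.Any.Properties using (lookup-index)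
  open import Data.Nat as ℕ using (ℕ; zero; suc)
  import Data.Nat.Properties as ℕ
  open import Data.Product using (∃; _×_; _,_; proj₁; proj₂)
  open import Data.Product.Properties using (≡-dec)
  open import Data.Sum using (inj₁; inj₂)
  open import Data.Vec using (Vec; []; _∷_; lookup; removeAt; tabulate)
  open import Data.Vec.Properties using (lookup∘tabulate; tabulate-cong)
  open import Function using (_∘_; Injective; id)
  open import Relation.Binary.PropositionalEquality
  open import Relation.Nullary using (Dec; yes; no; contradiction)
  open import Algebra.Properties.CommutativeMonoid.Sum +-0-commutativeMonoid using (sum; sum-permute)

  private variable n : ℕ

  expand≢0 : (K : ℤ → Vec ℤ n → ℤ) (w : Vec ℤ (suc n)) → expand K w ≢ 0ℤ →
             ∃ λ r → K (lookup w r) (removeAt w r) ≢ 0ℤ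
  expand≢0 {zero}  K (x ∷ []) ≢0 = zero , ≢0
  expand≢0 {suc n} K (x ∷ y ∷ w) ≢0 with K x (y ∷ w) ≟ 0ℤ
  ... | no  K≢0 = zero , K≢0
  ... | yes K≡0 with expand≢0 (λ z v → K z (x ∷ v)) (y ∷ w) (λ ≡0 → ≢0 (cong₂ _-_ K≡0 ≡0))
  ...   | r , found = suc r , found

  lookup-removeAt : (w : Vec ℤ (suc n)) (r : Fin (suc n)) (j : Fin n) →
                    lookup (removeAt w r) j ≡ lookup w (punchIn r j)
  lookup-removeAt (x ∷ w)     zero    j       = refl
  lookup-removeAt (x ∷ y ∷ w) (suc r) zero    = refl
  lookup-removeAt (x ∷ y ∷ w) (suc r) (suc j) = lookup-removeAt (y ∷ w) r j

  alternate≢0 : (F : Vec ℤ n → ℤ) (w : Vec ℤ n) → alternate F w ≢ 0ℤ →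
                ∃ λ (π : Permutation′ n) → F (tabulate λ j → lookup w (π ⟨$⟩ʳ j)) ≢ 0ℤ
  alternate≢0 {zero}  F [] ≢0 = idₚ , ≢0
  alternate≢0 {suc n} F w  ≢0 with expand≢0 (λ x → alternate (F ∘ (x ∷_))) w ≢0
  ... | r , ≢0′ with alternate≢0 (F ∘ (lookup w r ∷_)) (removeAt w r) ≢0′
  ...   | π , F≢0 = insert zero r π , subst (λ v → F (lookup w r ∷ v) ≢ 0ℤ)
          (tabulate-cong λ j → trans (lookup-removeAt w r (π ⟨$⟩ʳ j)) (cong (lookup w) (sym (insert-punchIn zero r π j)))) F≢0

  argmin : (a : Fin (suc n) → ℤ) → ∃ λ r → ∀ j → a r ≤ a j
  argmin {zero}  a = zero , λ { zero → ≤-refl }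
  argmin {suc n} a with argmin (a ∘ suc)
  ... | r , min with ≤-total (a zero) (a (suc r))
  ...   | inj₁ a₀≤ = zero  , λ { zero → ≤-refl ; (suc j) → ≤-trans a₀≤ (min j) }
  ...   | inj₂ ≤a₀ = suc r , λ { zero → ≤a₀    ; (suc j) → min j }

  increasing-∷ : ∀ {x} {v : Vec ℤ n} → (∀ j → x < lookup v j) → Increasing v → Increasing (x ∷ v)
  increasing-∷ {v = []}    x< inc = [ _ ]
  increasing-∷ {v = _ ∷ _} x< inc = x< zero ∷ inc

  sort : (a : Fin n → ℤ) → Injective _≡_ _≡_ a → ∃ λ (σ : Permutation′ n) → Increasing (tabulate λ j → a (σ ⟨$⟩ʳ j))
  sort {zero}  a a-inj = idₚ , []
  sort {suc n} a a-inj with argmin a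
  ... | r , min with sort (a ∘ punchIn r) (punchIn-injective r _ _ ∘ a-inj)
  ...   | σ , inc = insert zero r σ , increasing-∷
            (λ j → subst (a r <_) (sym (trans (lookup∘tabulate _ j) (cong a (insert-punchIn zero r σ j)))) (smaller (σ ⟨$⟩ʳ j)))
            (subst Increasing (tabulate-cong λ j → cong a (sym (insert-punchIn zero r σ j))) inc)
    where
    smaller : ∀ j → a r < a (punchIn r j)
    smaller j = ≤∧≢⇒< (min _) λ eq → punchInᵢ≢i r j (sym (a-inj eq))

  -- The alternating sum over the sorted values is positive, so one of its terms is nonzero;
  -- composing with the sorting permutation makes it an arrangement of `a`.
  nonzero-arrangement : (a : Fin n → ℤ) → Injective _≡_ _≡_ a → (F : Vec ℤ n → ℤ) → VandermondeBound F 1ℤ →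
                        ∃ λ (π : Permutation′ n) → F (tabulate λ j → a (π ⟨$⟩ʳ j)) ≢ 0ℤ
  nonzero-arrangement a a-inj F bound with sort a a-inj
  ... | σ , inc with alternate≢0 F (tabulate λ j → a (σ ⟨$⟩ʳ j)) (λ ≡0 → <-irrefl (sym ≡0) (alternate-positive F bound inc))
  ...   | π , F≢0 = π ∘ₚ σ , subst (λ v → F v ≢ 0ℤ) (tabulate-cong λ j → lookup∘tabulate _ (π ⟨$⟩ʳ j)) F≢0

  total-tabulate : (g : Fin n → ℤ) → total (tabulate g) ≡ sum g
  total-tabulate {zero}  g = refl
  total-tabulate {suc n} g = cong (g zero +_) (total-tabulate (g ∘ suc))

  prefix : ℕ → Vec ℤ n → ℤ
  prefix i w = prefixSum (lookup w) i

  prefix-tabulate : ∀ i (g : Fin n → ℤ) → prefix i (tabulate g) ≡ prefixSum g i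
  prefix-tabulate {zero}  i       g = refl
  prefix-tabulate {suc n} zero    g = refl
  prefix-tabulate {suc n} (suc i) g = cong (g zero +_) (prefix-tabulate i (g ∘ suc))

  prefix-bump : ∀ i (j : Fin n) w → prefix i (bump j w) ≡ prefix i w + step (suc (toℕ j)) i
  prefix-bump zero    zero    (x ∷ w) = refl
  prefix-bump zero    (suc j) (x ∷ w) = refl
  prefix-bump (suc i) zero    (x ∷ w) = lemma 1ℤ x (prefix i w)
    where
    lemma : ∀ a b c → a + b + c ≡ b + c + a
    lemma = solve-∀
  prefix-bump (suc i) (suc j) (x ∷ w) = trans (cong (x +_) (prefix-bump i j w)) (lemma x (prefix i w) _)
    where
    lemma : ∀ a b c → a + (b + c) ≡ a + b + c
    lemma = solve-∀

  -- On arrangements of total S this is m - prefix i; writing it with total makes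
  -- its slopes 0 and 1.
  avoid : ℤ → ℕ × ℤ → Vec ℤ n → ℤ
  avoid S (i , m) w = (m - S) + (total w - prefix i w)

  -- Raising coordinate `j` raises the total by 1, and the prefix by 1 exactly when `j < i`. The
  -- difference is the indicator of `i ≤ j`, which is `slope 0 j i`.
  avoid-form : ∀ S ((i , m) : ℕ × ℤ) → Form {n} 0 i (avoid S (i , m))
  avoid-form S (i , m) = affine λ j w → trans
    (cong₂ (λ t p → (m - S) + (t - p)) (total-bump j w) (prefix-bump i j w))
    (lemma (m - S) 1ℤ (total w) (prefix i w) _)
    where
    lemma : ∀ e o t p s → e + ((o + t) - (p + s)) ≡ e + (t - p) + (o - s)
    lemma = solve-∀

  intervals-valid : ∀ o n → All (λ (j , l) → j ℕ.≤ l) (intervals o n)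
  intervals-valid o zero    = []
  intervals-valid o (suc n) = ++⁺ (map⁺ (universal (λ j → ℕ.m≤m+n (suc o) (toℕ j)) (allFin n))) (intervals-valid (suc o) n)

  ∈-intervals : ∀ o n {j l} → o ℕ.< j → j ℕ.≤ l → l ℕ.< o ℕ.+ n → (j , l) ∈ intervals o n
  ∈-intervals o zero    o<j j≤l l<o = contradiction (ℕ.<-≤-trans (ℕ.<-≤-trans o<j j≤l) (ℕ.≤-trans (ℕ.n≤1+n _) l<o)) (ℕ.<-irrefl (sym (ℕ.+-identityʳ o)))
  ∈-intervals o (suc n) {j} {l} o<j j≤l l<o+n with ℕ.m≤n⇒m<n∨m≡n o<j
  ... | inj₁ 1+o<j = ∈-++⁺ʳ _ (∈-intervals (suc o) n 1+o<j j≤l (subst (l ℕ.<_) (ℕ.+-suc o n) l<o+n))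
  ... | inj₂ refl  = ∈-++⁺ˡ (subst (λ l → (suc o , l) ∈ intervalsAt (suc o) (allFin n)) end≡l
                       (∈-map⁺ (λ p → suc o , suc o ℕ.+ toℕ p) (∈-allFin (fromℕ< p<n))))
    where
    p<n : l ℕ.∸ suc o ℕ.< n
    p<n = ℕ.+-cancelˡ-< (suc o) _ _ (subst₂ ℕ._<_ (sym (ℕ.m+[n∸m]≡n j≤l)) (ℕ.+-suc o n) l<o+n)
    end≡l : suc o ℕ.+ toℕ (fromℕ< p<n) ≡ l
    end≡l = trans (cong (suc o ℕ.+_) (toℕ-fromℕ< p<n)) (ℕ.m+[n∸m]≡n j≤l)

  pointwise-map : ∀ {A B C : Set} {R : A → B → Set} {h : C → A} {g : C → B} {us} →
                  All (λ u → R (h u) (g u)) us → Pointwise R (map h us) (map g us)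
  pointwise-map []       = []
  pointwise-map (r ∷ rs) = r ∷ pointwise-map rs

  prod≢0 : ∀ (ℓs : List (Vec ℤ n → ℤ)) w → prod ℓs w ≢ 0ℤ → All (λ ℓ → ℓ w ≢ 0ℤ) ℓs
  prod≢0 []       w ≢0 = []
  prod≢0 (ℓ ∷ ℓs) w ≢0 = (λ ≡0 → ≢0 (cong (_* prod ℓs w) ≡0))
                       ∷ prod≢0 ℓs w (λ ≡0 → ≢0 (trans (cong (ℓ w *_) ≡0) (*-zeroʳ (ℓ w))))

  -- The linear factors attached to a matching.

  module Factors (K : ℕ) (b : Fin K → ℕ)
           (match : Lower K b → Upper K) (match-injective : Injective _≡_ _≡_ match)
           (adjacent : (d : Lower K b) → Adjacent {b = b} (match d) d)
           (M : (i : Fin K) → FinSetℤ (b i)) where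

    -- Shifted by one, because `intervals 0 (suc K)` lives on the points 1 to K, which count the
    -- jumps made.
    key : Lower K b → ℕ × ℕ
    key d = suc (toℕ (proj₁ (proj₁ (match d)))) , suc (toℕ (proj₂ (proj₁ (match d))))

    key-injective : Injective _≡_ _≡_ key
    key-injective {d} {e} eq = match-injective (upper≡ (match d) (match e)
      (toℕ-injective (ℕ.suc-injective (cong proj₁ eq))) (toℕ-injective (ℕ.suc-injective (cong proj₂ eq))))
      where
      upper≡ : (u v : Upper K) → proj₁ (proj₁ u) ≡ proj₁ (proj₁ v) → proj₂ (proj₁ u) ≡ proj₂ (proj₁ v) → u ≡ v
      upper≡ (_ , p) (_ , q) refl refl = cong (_ ,_) (ℕ.≤-irrelevant p q)

    key∈intervals : ∀ d → key d ∈ intervals 0 (suc K)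
    key∈intervals d = ∈-intervals 0 (suc K) (ℕ.s≤s ℕ.z≤n) (ℕ.s≤s (proj₂ (match d))) (ℕ.s≤s (toℕ<n _))

    matched? : (u : ℕ × ℕ) → Dec (∃ λ d → key d ≡ u)
    matched? u with any? (λ i → any? (λ t → ≡-dec ℕ._≟_ ℕ._≟_ (key (i , t)) u))
    ... | yes (i , t , eq) = yes ((i , t) , eq)
    ... | no  none         = no λ { ((i , t) , eq) → none (i , t , eq) }

    element : (d : Lower K b) → ℤ
    element (i , t) = lookupᴸ (proj₁ (M i)) (cast (sym (proj₂ (proj₂ (M i)))) t)

    target : Lower K b → ℕ × ℤ
    target d = suc (toℕ (proj₁ d)) , element d

    -- An unmatched interval gets an arbitrary factor that it covers, which brings
    -- the degree of the product up to the number of intervals.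
    factor : ℕ × ℕ → ℕ × ℤ
    factor u with matched? u
    ... | yes (d , _) = target d
    ... | no  _       = proj₁ u , 0ℤ

    factor-key : ∀ d → factor (key d) ≡ target d
    factor-key d with matched? (key d)
    ... | yes (e , eq) = cong target (key-injective eq)
    ... | no  none     = contradiction (d , refl) none

    factor-covered : ∀ {u} → proj₁ u ℕ.≤ proj₂ u → Covers u (proj₁ (factor u))
    factor-covered {u} j≤l with matched? u
    ... | yes (d , refl) = ℕ.s≤s (proj₁ (adjacent d)) , ℕ.s≤s (proj₂ (adjacent d))
    ... | no  _          = ℕ.≤-refl , j≤l

    element-index : ∀ i {x} (x∈ : x ∈ proj₁ (M i)) → x ≡ element (i , cast (proj₂ (proj₂ (M i))) (index x∈))
    element-index i x∈ = trans (lookup-index x∈) (cong (lookupᴸ (proj₁ (M i)))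
      (sym (trans (cast-trans len (sym len) (index x∈)) (cast-is-id (trans len (sym len)) (index x∈)))))
      where
      len : length (proj₁ (M i)) ≡ b i
      len = proj₂ (proj₂ (M i))

    factors : ℤ → List (Vec ℤ (suc K) → ℤ)
    factors S = map (avoid S ∘ factor) (intervals 0 (suc K))

    factors-bound : ∀ S → VandermondeBound (prod (factors S)) 1ℤ
    factors-bound S = proj₂
      (prod-bound 0 (pointwise-map {h = proj₁ ∘ factor} {us = us} (universal (λ u → avoid-form S (factor u)) us))
                    (length-map (proj₁ ∘ factor) us))
      (subst (λ vs → Pointwise Covers vs (map (proj₁ ∘ factor) us)) (map-id us)
        (pointwise-map {h = id} {g = proj₁ ∘ factor} (mapᴬ factor-covered (intervals-valid 0 (suc K)))))
      where
      us : List (ℕ × ℕ)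
      us = intervals 0 (suc K)

    -- A landing on an element of `M i` would annihilate the factor of the interval matched to that
    -- element, and with it the product.
    missed : ∀ S (g : Fin (suc K) → ℤ) → sum g ≡ S → prod (factors S) (tabulate g) ≢ 0ℤ →
             ∀ i → prefixSum g (suc (toℕ i)) ∉ proj₁ (M i)
    missed S g total≡S ≢0 i x∈ = lookupᴬ nonzero (key∈intervals d) (begin
      avoid S (factor (key d)) (tabulate g)    ≡⟨ cong (λ f → avoid S f (tabulate g)) (factor-key d) ⟩
      avoid S (target d) (tabulate g)          ≡⟨ cong₂ (λ t p → (element d - S) + (t - p))
                                                    (trans (total-tabulate g) total≡S)
                                                    (trans (prefix-tabulate (suc (toℕ i)) g) (element-index i x∈)) ⟩
      (element d - S) + (S - element d)        ≡⟨ cancel (element d) S ⟩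
      0ℤ                                       ∎)
      where
      open ≡-Reasoning
      d : Lower K b
      d = i , cast (proj₂ (proj₂ (M i))) (index x∈)
      nonzero : All (λ u → avoid S (factor u) (tabulate g) ≢ 0ℤ) (intervals 0 (suc K))
      nonzero = map⁻ (prod≢0 (factors S) (tabulate g) ≢0)
      cancel : ∀ m s → (m - s) + (s - m) ≡ 0ℤ
      cancel = solve-∀

  matching⇒admissible : ∀ K (b : Fin K → ℕ) → MatchingSequence (suc K) b → Admissible (suc K) b
  matching⇒admissible K b (match , match-injective , adjacent) a a-inj M =
    -- The sum of the jumps is the same for every arrangement, so the factors can be fixed before
    -- `π` is found.
    let S = sum a
        π , ≢0 = nonzero-arrangement a a-inj (prod (factors S)) (factors-bound S)
    in π , missed S (λ j → a (π ⟨$⟩ʳ j)) (sym (sum-permute a π)) ≢0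
    where open Factors K b match match-injective adjacent M

open import Defs
open import Data.Nat using (ℕ; zero; suc; _≤_; _∸_)
open import Data.Fin using (Fin)
open import Data.Product using (_×_; _,_)

theorem5p2 : (k : ℕ) → 2 ≤ k → (b : Fin (k ∸ 1) → ℕ) →
    ((Admissible k b → MatchingSequence k b) × (MatchingSequence k b → Admissible k b))
theorem5p2 zero    () b
theorem5p2 (suc K) _  b = Necessity.admissible⇒matching K b , Sufficiency.matching⇒admissible K b
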